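{- For every positive integer $n$ we have $g_5(n) < 1.2 \cdot 10^8$. That is, for every $n \ge 1$ and every set $A \subseteq \{1, 2, \ldots, 2n\}$ with $|A| \ge n + 1.2\cdot 10^8$, there exist pairwise distinct integers $b_1, \ldots, b_5$ with $b_i + b_j \in A$ for all $1 \le i < j \le 5$.
   Context: For positive integers $n$ and $k \ge 3$, $g_k(n)$ denotes the smallest integer such that for every set $A \subseteq \{1, 2, \ldots, 2n\}$ with $|A| \ge n + g_k(n)$ there exist pairwise distinct integers $b_1, \ldots, b_k$ (arbitrary integers, not required to be positive or to lie in $A$) with $b_i + b_j \in A$ for all $1 \le i < j \le k$. -}

module Defs where

open import Data.Nat using (ℕ; _≤_; _<_; _+_)
open import Data.Integer using (ℤ; +_) renaming (_+_ to _+ℤ_)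
open import Data.Fin using (Fin)
open import Data.List using (List; length)
open import Data.List.Membership.Propositional using (_∈_)
open import Data.List.Relation.Unary.All using (All)
open import Data.List.Relation.Unary.Unique.Propositional using (Unique)
open import Data.Product using (Σ; _×_; ∃)
open import Function.Definitions using (Injective)
open import Relation.Binary.PropositionalEquality using (_≡_)

-- A finite set A ⊆ {1,…,2n}, represented as a duplicate-free list; |A| = length A.
SubsetOf2n : ℕ → List ℕ → Set
SubsetOf2n n A = Unique A × All (λ a → 1 ≤ a × a ≤ n + n) A

_∈ℤ_ : ℤ → List ℕ → Set
x ∈ℤ A = Σ ℕ (λ a → (a ∈ A) × (x ≡ + a))

HasSumClique : ℕ → List ℕ → Set
HasSumClique k A =
  Σ (Fin k → ℤ) λ b →
    Injective _≡_ _≡_ b ×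
    (∀ (i j : Fin k) → Data.Fin._<_ i j → (b i +ℤ b j) ∈ℤ A)

{-# OPTIONS --safe #-}

-- Write the even elements of A as 2(B + i) and the odd ones as 2(B + i) − 1, let E and D be the
-- two index sets, and let O be the complement of D. The hypothesis says |E| ≥ |O| + C. This
-- survives trimming to a window of m indices whose first and last indices lie in E; m ≥ |E| ≥ C.
--
-- If |E| < m/14, choose x, y, z whose pair sums are three even elements of A lying close together,
-- and u, v = s/2 ± t, where s is an even element of A at the opposite end of the window and t has
-- the parity that makes the six cross sums odd. Each missing odd number spoils at most three values
-- of t, and |O| is smaller than a third of the number of admissible t.
--
-- If |E| ≥ m/14, let S = E when |E| ≥ m/4 and S = D otherwise. Averaging gives a shift δ with
-- E ∩ (S − δ) of density at least 1/40, and averaging three more times gives a 3-cube in it.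
-- The cube yields four integers with pair sums in E, and the shifted cube a fifth one whose sums
-- with these lie in S. Squaring the density 1/40 twice is what m ≥ 1.2·10⁸ pays for.
module Submission where

open import Defs
open import Data.Bool using (Bool; true; false; not; _∧_; _∨_)
open import Data.Bool.Properties using (∧-identityʳ)
open import Data.Fin using (Fin; zero; suc)
import Data.Fin as Fin
open import Data.Integer using (ℤ; +_)
import Data.Integer as ℤ
import Data.Integer.Properties as ℤ
import Data.Integer.Tactic.RingSolver as ℤSolver
import Algebra.Properties.AbelianGroup ℤ.+-0-abelianGroup as ℤ+
open import Data.List using (List; []; _∷_; length)
import Data.List as List
open import Data.List.Membership.DecPropositional ℤ._≟_ using (_∈?_)
open import Data.List.Membership.Propositional using (_∉_)
open import Data.List.Membership.Propositional.Properties using (∈-map⁻)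
open import Data.List.Properties using (length-map)
open import Data.List.Relation.Unary.All using (All)
import Data.List.Relation.Unary.All as All
import Data.List.Relation.Unary.All.Properties as All
import Data.List.Relation.Unary.AllPairs as AllPairs
open import Data.List.Relation.Unary.Any using (here; there)
import Data.List.Relation.Unary.Unique.Propositional as List
import Data.List.Relation.Unary.Unique.Propositional.Properties as Unique
open import Data.Nat
open import Data.Nat.DivMod using (m≡m%n+[m/n]*n; m%n<n)
open import Data.Nat.Properties
import Data.Nat.Tactic.RingSolver as ℕSolver
open import Data.Product using (_×_; _,_; ∃-syntax; proj₁; proj₂)
open import Data.Sum using (_⊎_; inj₁; inj₂)
open import Data.Vec using (Vec; []; _∷_; lookup)
open import Data.Vec.Relation.Unary.All using ([]; _∷_)
open import Data.Vec.Relation.Unary.All.Properties using (lookup⁺)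
open import Data.Vec.Relation.Unary.AllPairs using (AllPairs; []; _∷_)
open import Data.Vec.Relation.Unary.Unique.Propositional using (Unique)
open import Data.Vec.Relation.Unary.Unique.Propositional.Properties using (lookup-injective)
open import Function using (_∘_)
open import Relation.Binary.PropositionalEquality
  using (_≡_; _≢_; refl; sym; trans; cong; cong₂; subst; subst₂; module ≡-Reasoning)
open import Relation.Nullary using (Dec; does; yes; no; contradiction)
open import Relation.Nullary.Decidable using (dec-true; dec-false)

-- Finite sums of natural numbers.

∑ : ℕ → (ℕ → ℕ) → ℕ
∑ zero    f = 0
∑ (suc n) f = ∑ n f + f n

∑-mono : ∀ n {f g : ℕ → ℕ} → (∀ i → i < n → f i ≤ g i) → ∑ n f ≤ ∑ n g
∑-mono zero    f≤g = z≤n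
∑-mono (suc n) f≤g = +-mono-≤ (∑-mono n λ i i<n → f≤g i (m<n⇒m<1+n i<n)) (f≤g n ≤-refl)

∑-cong : ∀ n {f g : ℕ → ℕ} → (∀ i → i < n → f i ≡ g i) → ∑ n f ≡ ∑ n g
∑-cong zero    f≡g = refl
∑-cong (suc n) f≡g = cong₂ _+_ (∑-cong n λ i i<n → f≡g i (m<n⇒m<1+n i<n)) (f≡g n ≤-refl)

∑-const : ∀ n c → ∑ n (λ _ → c) ≡ n * c
∑-const zero    c = refl
∑-const (suc n) c = trans (cong (_+ c) (∑-const n c)) (+-comm (n * c) c)

∑-+ : ∀ n (f g : ℕ → ℕ) → ∑ n (λ i → f i + g i) ≡ ∑ n f + ∑ n g
∑-+ zero    f g = refl
∑-+ (suc n) f g = trans (cong (_+ (f n + g n)) (∑-+ n f g)) (interchange (∑ n f) (∑ n g) (f n) (g n))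
  where
  interchange : ∀ a b c d → a + b + (c + d) ≡ a + c + (b + d)
  interchange = ℕSolver.solve-∀

∑-*ʳ : ∀ n (f : ℕ → ℕ) c → ∑ n (λ i → f i * c) ≡ ∑ n f * c
∑-*ʳ zero    f c = refl
∑-*ʳ (suc n) f c = trans (cong (_+ f n * c) (∑-*ʳ n f c)) (sym (*-distribʳ-+ c (∑ n f) (f n)))

∑-swap : ∀ m n (f : ℕ → ℕ → ℕ) → ∑ m (λ i → ∑ n (f i)) ≡ ∑ n (λ j → ∑ m (λ i → f i j))
∑-swap zero    n f = sym (trans (∑-const n 0) (*-zeroʳ n))
∑-swap (suc m) n f =
  trans (cong (_+ ∑ n (f m)) (∑-swap m n f)) (sym (∑-+ n (λ j → ∑ m (λ i → f i j)) (f m)))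

∑-split : ∀ m n (f : ℕ → ℕ) → ∑ (m + n) f ≡ ∑ m f + ∑ n (λ i → f (m + i))
∑-split m zero    f rewrite +-identityʳ m = sym (+-identityʳ _)
∑-split m (suc n) f rewrite +-suc m n =
  trans (cong (_+ f (m + n)) (∑-split m n f)) (+-assoc (∑ m f) _ _)

∑-reverse : ∀ n (f : ℕ → ℕ) → ∑ n (λ i → f (n ∸ suc i)) ≡ ∑ n f
∑-reverse zero    f = refl
∑-reverse (suc n) f = begin
  ∑ (1 + n) (λ i → f (n ∸ i))           ≡⟨ ∑-split 1 n (λ i → f (n ∸ i)) ⟩
  f n + ∑ n (λ i → f (n ∸ suc i))       ≡⟨ cong (λ x → f n + x) (∑-reverse n f) ⟩
  f n + ∑ n f                           ≡⟨ +-comm (f n) _ ⟩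
  ∑ n f + f n                           ∎
  where open ≡-Reasoning

∑-segment : ∀ a n {N} (f : ℕ → ℕ) → a + n ≤ N → ∑ n (λ i → f (a + i)) ≤ ∑ N f
∑-segment a n {N} f a+n≤N with m≤n⇒∃[o]m+o≡n a+n≤N
... | k , refl = begin
  ∑ n (λ i → f (a + i))            ≤⟨ m≤n+m _ (∑ a f) ⟩
  ∑ a f + ∑ n (λ i → f (a + i))    ≡⟨ ∑-split a n f ⟨
  ∑ (a + n) f                      ≤⟨ m≤m+n _ _ ⟩
  ∑ (a + n) f + ∑ k (λ i → f (a + n + i)) ≡⟨ ∑-split (a + n) k f ⟨
  ∑ (a + n + k) f                  ∎
  where open ≤-Reasoning

∑-positive : ∀ n (f : ℕ → ℕ) → 0 < ∑ n f → ∃[ i ] i < n × 0 < f i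
∑-positive (suc n) f 0<∑ with f n in eq
... | suc _ = n , ≤-refl , subst (0 <_) (sym eq) z<s
... | zero  with ∑-positive n f (subst (0 <_) (+-identityʳ _) 0<∑)
...   | i , i<n , 0<fi = i , m<n⇒m<1+n i<n , 0<fi

-- An index of a maximum serves. No bound `k < n` is claimed, so that the empty sum can answer 0.
∑-average : ∀ n (f : ℕ → ℕ) → ∃[ k ] ∑ n f ≤ n * f k
∑-average zero    f = 0 , z≤n
∑-average (suc n) f with ∑-average n f
... | k , ∑≤nfk with ≤-total (f n) (f k)
...   | inj₁ fn≤fk = k , ≤-trans (+-mono-≤ ∑≤nfk fn≤fk) (≤-reflexive (+-comm (n * f k) (f k)))
...   | inj₂ fk≤fn = n , ≤-trans (+-monoˡ-≤ (f n) (≤-trans ∑≤nfk (*-monoʳ-≤ n fk≤fn)))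
                                 (≤-reflexive (+-comm (n * f n) (f n)))

-- Counting members of integer sets in a window; popular differences.

⟦_⟧ : Bool → ℕ
⟦ true  ⟧ = 1
⟦ false ⟧ = 0

⟦⟧≤1 : ∀ b → ⟦ b ⟧ ≤ 1
⟦⟧≤1 true  = ≤-refl
⟦⟧≤1 false = z≤n

⟦⟧-positive : ∀ {b} → 0 < ⟦ b ⟧ → b ≡ true
⟦⟧-positive {true} _ = refl

does-true : ∀ {a} {A : Set a} (A? : Dec A) → does A? ≡ true → A
does-true (yes a) _ = a

∧-true : ∀ {a b} → a ∧ b ≡ true → a ≡ true × b ≡ true
∧-true {true} b≡true = refl , b≡true

∑-atMostOne : ∀ n (p : ℕ → Bool) → (∀ i j → p i ≡ true → p j ≡ true → i ≡ j) → ∑ n (⟦_⟧ ∘ p) ≤ 1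
∑-atMostOne zero    p unique = z≤n
∑-atMostOne (suc n) p unique with p n in pn
... | false = subst (_≤ 1) (sym (+-identityʳ _)) (∑-atMostOne n p unique)
... | true  = +-monoˡ-≤ 1 (≤-trans (∑-mono n vanish) (≤-reflexive (trans (∑-const n 0) (*-zeroʳ n))))
  where
  vanish : ∀ i → i < n → ⟦ p i ⟧ ≤ 0
  vanish i i<n with p i in pi
  ... | false = z≤n
  ... | true  = contradiction (unique i n pi pn) (<⇒≢ i<n)

-- Sets live on all of ℤ and only the count `♯` is confined to the window, so translates need no
-- range conditions.
Pred : Set
Pred = ℤ → Bool

♯ : Pred → ℕ → ℕ
♯ P m = ∑ m (λ i → ⟦ P (+ i) ⟧)

infixr 6 _∩[_]_

_∩[_]_ : Pred → ℤ → Pred → Pred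
(P ∩[ δ ] Q) z = P z ∧ Q (z ℤ.+ δ)

♯-witness : ∀ m P → 0 < ♯ P m → ∃[ z ] P z ≡ true
♯-witness m P 0<♯ with ∑-positive m _ 0<♯
... | i , _ , 0<Pi = + i , ⟦⟧-positive 0<Pi

-- Each entry `φ` of `F` rules out at most one index, namely `φ + c`.
♯-avoid : ∀ m (Q : Pred) c (F : List ℤ) →
  ♯ Q m ≤ ♯ (λ z → Q z ∧ not (does ((z ℤ.- c) ∈? F))) m + length F
♯-avoid m Q c [] = ≤-reflexive (trans
  (∑-cong m λ i _ → cong ⟦_⟧ (sym (∧-identityʳ (Q (+ i))))) (sym (+-identityʳ _)))
♯-avoid m Q c (φ ∷ F) = begin
  ♯ Q m                                     ≤⟨ ♯-avoid m Q c F ⟩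
  ♯ (avoiding F) m + length F               ≤⟨ +-monoˡ-≤ (length F) (∑-mono m λ i _ → pointwise (Q (+ i)) _ _) ⟩
  ∑ m (λ i → ⟦ avoiding (φ ∷ F) (+ i) ⟧ + ⟦ hit i ⟧) + length F
                                            ≡⟨ cong (_+ length F) (∑-+ m _ (⟦_⟧ ∘ hit)) ⟩
  ♯ (avoiding (φ ∷ F)) m + ∑ m (⟦_⟧ ∘ hit) + length F
                                            ≤⟨ +-monoˡ-≤ (length F) (+-monoʳ-≤ (♯ (avoiding (φ ∷ F)) m) (∑-atMostOne m hit hit-unique)) ⟩
  ♯ (avoiding (φ ∷ F)) m + 1 + length F     ≡⟨ +-assoc (♯ (avoiding (φ ∷ F)) m) 1 (length F) ⟩
  ♯ (avoiding (φ ∷ F)) m + length (φ ∷ F)   ∎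
  where
  open ≤-Reasoning

  avoiding : List ℤ → Pred
  avoiding G z = Q z ∧ not (does ((z ℤ.- c) ∈? G))

  hit : ℕ → Bool
  hit i = does ((+ i ℤ.- c) ℤ.≟ φ)

  pointwise : ∀ q a b → ⟦ q ∧ not b ⟧ ≤ ⟦ q ∧ not (a ∨ b) ⟧ + ⟦ a ⟧
  pointwise false a     b     = z≤n
  pointwise true  false b     = m≤m+n _ _
  pointwise true  true  false = ≤-refl
  pointwise true  true  true  = z≤n

  hit-unique : ∀ i j → hit i ≡ true → hit j ≡ true → i ≡ j
  hit-unique i j hi hj = ℤ.+-injective (ℤ+.∙-cancelʳ (ℤ.- c) (+ i) (+ j)
    (trans (does-true (_ ℤ.≟ φ) hi) (sym (does-true (_ ℤ.≟ φ) hj))))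

-- Averaging over the 2m possible differences of a pair (p, q) ∈ P × Q.
popularDifference : ∀ m (P Q : Pred) (F : List ℤ) → 0 < ♯ P m * (♯ Q m ∸ length F) →
  ∃[ δ ] δ ∉ F × ♯ P m * (♯ Q m ∸ length F) ≤ (m + m) * ♯ (P ∩[ δ ] Q) m
popularDifference m P Q F positive = δ k , k∉F , ≤-trans enough (*-monoʳ-≤ (m + m) h≤♯)
  where
  open ≤-Reasoning

  -- For `k < 2m` this runs over the differences from `-m` to `m - 1`; the difference `j - i` sits
  -- at `k = m - i + j`.
  δ : ℕ → ℤ
  δ k = + k ℤ.- + m

  free : ℤ → Bool
  free d = not (does (d ∈? F))

  pair : ℕ → ℕ → Bool
  pair i k = P (+ i) ∧ (Q (+ i ℤ.+ δ k) ∧ free (δ k))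

  h : ℕ → ℕ
  h k = ∑ m (λ i → ⟦ pair i k ⟧)

  reindex : ∀ a i j m → a ℤ.+ i ≡ m → (a ℤ.+ j) ℤ.- m ≡ j ℤ.- i
  reindex a i j _ refl = lemma a i j
    where
    lemma : ∀ a i j → (a ℤ.+ j) ℤ.- (a ℤ.+ i) ≡ j ℤ.- i
    lemma = ℤSolver.solve-∀

  undo : ∀ i j → i ℤ.+ (j ℤ.- i) ≡ j
  undo = ℤSolver.solve-∀

  row : ∀ i → i < m → ♯ Q m ∸ length F ≤ ∑ (m + m) (λ k → ⟦ Q (+ i ℤ.+ δ k) ∧ free (δ k) ⟧)
  row i i<m = begin
    ♯ Q m ∸ length F
      ≤⟨ m≤n+o⇒m∸n≤o (♯ Q m) (length F) (≤-trans (♯-avoid m Q (+ i) F) (≤-reflexive (+-comm _ (length F)))) ⟩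
    ∑ m (λ j → ⟦ Q (+ j) ∧ free (+ j ℤ.- + i) ⟧)
      ≡⟨ ∑-cong m (λ j _ → cong₂ (λ x y → ⟦ Q x ∧ free y ⟧)
           (sym (trans (cong (ℤ._+_ (+ i)) (eq j)) (undo (+ i) (+ j)))) (sym (eq j))) ⟩
    ∑ m (λ j → ⟦ Q (+ i ℤ.+ δ (m ∸ i + j)) ∧ free (δ (m ∸ i + j)) ⟧)
      ≤⟨ ∑-segment (m ∸ i) m (λ k → ⟦ Q (+ i ℤ.+ δ k) ∧ free (δ k) ⟧) (+-monoˡ-≤ m (m∸n≤m m i)) ⟩
    ∑ (m + m) (λ k → ⟦ Q (+ i ℤ.+ δ k) ∧ free (δ k) ⟧) ∎
    where
    eq : ∀ j → δ (m ∸ i + j) ≡ + j ℤ.- + i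
    eq j = trans (cong (ℤ._- + m) (ℤ.pos-+ (m ∸ i) j))
      (reindex (+ (m ∸ i)) (+ i) (+ j) (+ m) (trans (sym (ℤ.pos-+ (m ∸ i) i)) (cong +_ (m∸n+n≡m (<⇒≤ i<m)))))

  rowP : ∀ i → i < m → ⟦ P (+ i) ⟧ * (♯ Q m ∸ length F) ≤ ∑ (m + m) (λ k → ⟦ pair i k ⟧)
  rowP i i<m with P (+ i)
  ... | true  = ≤-trans (≤-reflexive (+-identityʳ _)) (row i i<m)
  ... | false = z≤n

  total : ♯ P m * (♯ Q m ∸ length F) ≤ ∑ (m + m) h
  total = begin
    ♯ P m * (♯ Q m ∸ length F)                            ≡⟨ ∑-*ʳ m (λ i → ⟦ P (+ i) ⟧) _ ⟨
    ∑ m (λ i → ⟦ P (+ i) ⟧ * (♯ Q m ∸ length F))          ≤⟨ ∑-mono m rowP ⟩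
    ∑ m (λ i → ∑ (m + m) (λ k → ⟦ pair i k ⟧))            ≡⟨ ∑-swap m (m + m) _ ⟩
    ∑ (m + m) h                                           ∎

  k : ℕ
  k = proj₁ (∑-average (m + m) h)

  enough : ♯ P m * (♯ Q m ∸ length F) ≤ (m + m) * h k
  enough = ≤-trans total (proj₂ (∑-average (m + m) h))

  h≤♯ : h k ≤ ♯ (P ∩[ δ k ] Q) m
  h≤♯ = ∑-mono m λ i _ → drop (P (+ i)) _ _
    where
    drop : ∀ a b c → ⟦ a ∧ (b ∧ c) ⟧ ≤ ⟦ a ∧ b ⟧
    drop false b     c     = z≤n
    drop true  false c     = z≤n
    drop true  true  c     = ⟦⟧≤1 c

  -- `pair` contains the test `free`, so a forbidden `δ k` has `h k = 0`, which the positive average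
  -- excludes.
  k∉F : δ k ∉ F
  k∉F δ∈F with h k in hk
  ... | zero  = contradiction (≤-trans positive (≤-trans enough (≤-reflexive (trans (cong ((m + m) *_) hk) (*-zeroʳ (m + m)))))) λ ()
  ... | suc _ with ∑-positive m _ (subst (0 <_) (sym hk) z<s)
  ...   | i , _ , 0<pair with proj₂ (∧-true {Q (+ i ℤ.+ δ k)} (proj₂ (∧-true {P (+ i)} (⟦⟧-positive 0<pair))))
  ...     | isFree with δ k ∈? F
  ...       | yes _   = contradiction isFree λ ()
  ...       | no  δ∉F = δ∉F δ∈F

lookup-allPairs : ∀ {n} {R : ℤ → ℤ → Set} {xs : Vec ℤ n} → AllPairs R xs →
  ∀ (i j : Fin n) → i Fin.< j → R (lookup xs i) (lookup xs j)
lookup-allPairs (Rx ∷ _)  zero    (suc j) _         = lookup⁺ Rx j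
lookup-allPairs (_  ∷ Rs) (suc i) (suc j) (s≤s i<j) = lookup-allPairs Rs i j i<j

sumClique : ∀ {k} (A : List ℕ) (b : Vec ℤ k) → Unique b →
  AllPairs (λ x y → (x ℤ.+ y) ∈ℤ A) b → HasSumClique k A
sumClique A b distinct sums =
  lookup b , (λ {i} {j} → lookup-injective distinct i j) , lookup-allPairs sums

-- Densities, and Hilbert cubes in dense sets.

*-positiveʳ : ∀ {m} a {n} → 0 < m → m ≤ a * n → 0 < n
*-positiveʳ a {zero}  0<m m≤an = contradiction (≤-trans 0<m (≤-trans m≤an (≤-reflexive (*-zeroʳ a)))) λ ()
*-positiveʳ a {suc n} _   _    = z<s

*-positive : ∀ {m n} → 0 < m → 0 < n → 0 < m * n
*-positive {suc m} {suc n} _ _ = z<s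

≤-factor : ∀ {m} a {k n} → 0 < m → a * k ≤ m → m ≤ a * n → k ≤ n
≤-factor zero    0<m _     m≤0  = contradiction (≤-trans 0<m m≤0) λ ()
≤-factor (suc a) _   ak≤m  m≤an = *-cancelˡ-≤ (suc a) (≤-trans ak≤m m≤an)

-- The size condition gives `(a+1)f ≤ n`, hence `(a+1)(n - f) = an + n - (a+1)f ≥ an ≥ m`.
density-∸ : ∀ {m} a f {n} → 0 < m → a * (suc a * f) ≤ m → m ≤ a * n → m ≤ suc a * (n ∸ f)
density-∸ {m} a f {n} 0<m large m≤an = begin
  m                        ≤⟨ m≤an ⟩
  a * n                    ≡⟨ m+n∸m≡n n (a * n) ⟨
  suc a * n ∸ n            ≤⟨ ∸-monoʳ-≤ (suc a * n) (≤-factor a 0<m large m≤an) ⟩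
  suc a * n ∸ suc a * f    ≡⟨ *-distribˡ-∸ (suc a) n f ⟨
  suc a * (n ∸ f)          ∎
  where open ≤-Reasoning

-- One factor `m` cancels from `m² ≤ ab·np ≤ 2ab·mq`.
density-pairs : ∀ {m} a b {n p q} → 0 < m → m ≤ a * n → m ≤ b * p → n * p ≤ (m + m) * q →
  m ≤ 2 * (a * b) * q
density-pairs {m} a b {n} {p} {q} 0<m m≤an m≤bp np≤mmq =
  *-cancelˡ-≤ m {{>-nonZero 0<m}} (begin
    m * m                      ≤⟨ *-mono-≤ m≤an m≤bp ⟩
    (a * n) * (b * p)          ≡⟨ regroup a n b p ⟩
    (a * b) * (n * p)          ≤⟨ *-monoʳ-≤ (a * b) np≤mmq ⟩
    (a * b) * ((m + m) * q)    ≡⟨ regroup′ a b m q ⟩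
    m * (2 * (a * b) * q)      ∎)
  where
  open ≤-Reasoning
  regroup : ∀ a n b p → (a * n) * (b * p) ≡ (a * b) * (n * p)
  regroup = ℕSolver.solve-∀
  regroup′ : ∀ a b m q → (a * b) * ((m + m) * q) ≡ m * (2 * (a * b) * q)
  regroup′ = ℕSolver.solve-∀

-- A set of density 1/a meets one of its translates in density 1/next a; that the second factor is
-- suc a rather than a absorbs the loss from the forbidden differences.
next : ℕ → ℕ
next a = 2 * (a * suc a)

selfDifference : ∀ {m} a (X : Pred) (F : List ℤ) → 0 < m → a * (suc a * length F) ≤ m → m ≤ a * ♯ X m →
  ∃[ d ] d ∉ F × m ≤ next a * ♯ (X ∩[ d ] X) m
selfDifference {m} a X F 0<m large dense
  with density-∸ a (length F) 0<m large dense
... | dense′ with popularDifference m X X F (*-positive (*-positiveʳ a 0<m dense) (*-positiveʳ (suc a) 0<m dense′))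
...   | d , d∉F , popular = d , d∉F , density-pairs a (suc a) 0<m dense dense′ popular

∩-left : ∀ {P δ Q z} → (P ∩[ δ ] Q) z ≡ true → P z ≡ true
∩-left = proj₁ ∘ ∧-true

∩-right : ∀ {P δ Q z} → (P ∩[ δ ] Q) z ≡ true → Q (z ℤ.+ δ) ≡ true
∩-right {P} {z = z} = proj₂ ∘ ∧-true {P z}

-- The corners of a Hilbert cube that use at most two of its sides: these are the points called for
-- by the pair sums of four integers and by their sums with a fifth.
record Cube (X : Pred) (x d e f : ℤ) : Set where
  constructor cube
  field
    X-0  : X x ≡ true
    X-d  : X (x ℤ.+ d) ≡ true
    X-e  : X (x ℤ.+ e) ≡ true
    X-f  : X (x ℤ.+ f) ≡ true
    X-de : X (x ℤ.+ e ℤ.+ d) ≡ true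
    X-df : X (x ℤ.+ f ℤ.+ d) ≡ true
    X-ef : X (x ℤ.+ f ℤ.+ e) ≡ true

cube-∩ : ∀ {X Y Z : Pred} {x d e f} → Y ≡ X ∩[ d ] X → Z ≡ Y ∩[ e ] Y → (Z ∩[ f ] Z) x ≡ true → Cube X x d e f
cube-∩ {X} {Y} {Z} {x} {d} {e} {f} Y-def Z-def x∈ = cube
  (X∩-left Y-0) (X∩-right Y-0) (X∩-left Y-e) (X∩-left Y-f)
  (X∩-right Y-e) (X∩-right Y-f) (X∩-left (Y∩-right Z-f))
  where
  X∩-left : ∀ {z} → Y z ≡ true → X z ≡ true
  X∩-left {z} z∈Y = ∩-left {X} {d} {X} (trans (cong (λ P → P z) (sym Y-def)) z∈Y)
  X∩-right : ∀ {z} → Y z ≡ true → X (z ℤ.+ d) ≡ true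
  X∩-right {z} z∈Y = ∩-right {X} {d} {X} (trans (cong (λ P → P z) (sym Y-def)) z∈Y)
  Y∩-left : ∀ {z} → Z z ≡ true → Y z ≡ true
  Y∩-left {z} z∈Z = ∩-left {Y} {e} {Y} (trans (cong (λ P → P z) (sym Z-def)) z∈Z)
  Y∩-right : ∀ {z} → Z z ≡ true → Y (z ℤ.+ e) ≡ true
  Y∩-right {z} z∈Z = ∩-right {Y} {e} {Y} (trans (cong (λ P → P z) (sym Z-def)) z∈Z)
  Z-0 : Z x ≡ true
  Z-0 = ∩-left {Z} {f} {Z} x∈
  Z-f : Z (x ℤ.+ f) ≡ true
  Z-f = ∩-right {Z} {f} {Z} x∈
  Y-0 : Y x ≡ true
  Y-0 = Y∩-left Z-0
  Y-e : Y (x ℤ.+ e) ≡ true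
  Y-e = Y∩-right Z-0
  Y-f : Y (x ℤ.+ f) ≡ true
  Y-f = Y∩-left Z-f

-- For the last side of a cube a single point suffices, so a density hypothesis is replaced by
-- having more members than forbidden differences.
selfDifference-witness : ∀ {m} (X : Pred) (F : List ℤ) → length F < ♯ X m →
  ∃[ d ] d ∉ F × ∃[ x ] (X ∩[ d ] X) x ≡ true
selfDifference-witness {m} X F F<♯ = d , d∉F , ♯-witness m (X ∩[ d ] X) (*-positiveʳ (m + m) positive popular)
  where
  positive = *-positive (≤-trans (s≤s z≤n) F<♯) (m<n⇒0<n∸m F<♯)
  d = proj₁ (popularDifference m X X F positive)
  d∉F = proj₁ (proj₂ (popularDifference m X X F positive))
  popular = proj₂ (proj₂ (popularDifference m X X F positive))

-- The densities run through 1/`a`, 1/`next a`, 1/`next (next a)`, while each chosen side joins the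
-- forbidden list. The three size hypotheses pay for the three choices.
threeCube : ∀ {m} a (X : Pred) (F : List ℤ) → 0 < m →
  a * (suc a * length F) ≤ m →
  next a * (suc (next a) * (1 + length F)) ≤ m →
  next (next a) * (3 + length F) ≤ m →
  m ≤ a * ♯ X m →
  ∃[ x ] ∃[ d ] ∃[ e ] ∃[ f ] d ∉ F × e ∉ d ∷ F × f ∉ e ∷ d ∷ F × Cube X x d e f
threeCube {m} a X F 0<m large₁ large₂ large₃ dense =
  let d , d∉ , dense₁ = selfDifference a X F 0<m large₁ dense
      Y = X ∩[ d ] X
      e , e∉ , dense₂ = selfDifference (next a) Y (d ∷ F) 0<m large₂ dense₁
      Z = Y ∩[ e ] Y
      -- `large₃` yields `3 + length F ≤ ♯ Z m`, one more than the length of `e ∷ d ∷ F`.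
      f , f∉ , x , x∈ = selfDifference-witness {m} Z (e ∷ d ∷ F) (≤-factor (next (next a)) 0<m large₃ dense₂)
  in x , d , e , f , d∉ , e∉ , f∉ , cube-∩ refl refl x∈

-- The six pair sums of B + x + {0, 2d, 2e, 2f} and the four sums with b₅ correspond to corners of
-- the cube, read in E and in S − δ respectively.
cube⇒sumClique : ∀ (A : List ℕ) (B τ : ℤ) (E S : Pred) →
  (∀ z → E z ≡ true → (+ 2 ℤ.* (B ℤ.+ z)) ∈ℤ A) →
  (∀ z → S z ≡ true → (+ 2 ℤ.* (B ℤ.+ z) ℤ.- τ) ∈ℤ A) →
  (∀ {δ d} → δ ≢ d → + 2 ℤ.* d ≢ + 2 ℤ.* δ ℤ.- τ) →
  ∀ {x d e f δ} → δ ∉ + 0 ∷ [] → d ∉ + 0 ∷ δ ∷ [] → e ∉ d ∷ + 0 ∷ δ ∷ [] → f ∉ e ∷ d ∷ + 0 ∷ δ ∷ [] →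
  Cube (E ∩[ δ ] S) x d e f → HasSumClique 5 A
cube⇒sumClique A B τ E S evens others τ-distinct {x} {d} {e} {f} {δ} δ∉ d∉ e∉ f∉
  (cube X-0 X-d X-e X-f X-de X-df X-ef) = sumClique A
  (b (+ 0) ∷ b d ∷ b e ∷ b f ∷ b₅ ∷ [])
  ( (b-≢ (d∉ ∘ here ∘ sym) ∷ b-≢ (e∉ ∘ there ∘ here ∘ sym) ∷ b-≢ (f∉ ∘ there ∘ there ∘ here ∘ sym)
      ∷ b₅-≢ (δ∉ ∘ here) ∷ [])
  ∷ (b-≢ (e∉ ∘ here ∘ sym) ∷ b-≢ (f∉ ∘ there ∘ here ∘ sym) ∷ b₅-≢ (d∉ ∘ there ∘ here ∘ sym) ∷ [])
  ∷ (b-≢ (f∉ ∘ here ∘ sym) ∷ b₅-≢ (e∉ ∘ there ∘ there ∘ here ∘ sym) ∷ [])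
  ∷ (b₅-≢ (f∉ ∘ there ∘ there ∘ there ∘ here ∘ sym) ∷ [])
  ∷ [] ∷ [])
  ( (even X-d (sum₁ B x d) ∷ even X-e (sum₁ B x e) ∷ even X-f (sum₁ B x f) ∷ other X-0 (sum₃ B x δ τ) ∷ [])
  ∷ (even X-de (sum₂ B x d e) ∷ even X-df (sum₂ B x d f) ∷ other X-d (sum₄ B x d δ τ) ∷ [])
  ∷ (even X-ef (sum₂ B x e f) ∷ other X-e (sum₄ B x e δ τ) ∷ [])
  ∷ (other X-f (sum₄ B x f δ τ) ∷ [])
  ∷ [] ∷ [])
  where
  X : Pred
  X = E ∩[ δ ] S

  b : ℤ → ℤ
  b d = B ℤ.+ x ℤ.+ + 2 ℤ.* d

  b₅ : ℤ
  b₅ = B ℤ.+ x ℤ.+ (+ 2 ℤ.* δ ℤ.- τ)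

  b-≢ : ∀ {c d} → c ≢ d → b c ≢ b d
  b-≢ c≢d eq = c≢d (ℤ.*-cancelˡ-≡ (+ 2) _ _ (ℤ+.∙-cancelˡ (B ℤ.+ x) _ _ eq))

  b₅-≢ : ∀ {d} → δ ≢ d → b d ≢ b₅
  b₅-≢ δ≢d eq = τ-distinct δ≢d (ℤ+.∙-cancelˡ (B ℤ.+ x) _ _ eq)

  even : ∀ {z y} → X z ≡ true → y ≡ + 2 ℤ.* (B ℤ.+ z) → y ∈ℤ A
  even {z} z∈X refl = evens z (∩-left {E} {δ} {S} z∈X)

  other : ∀ {z y} → X z ≡ true → y ≡ + 2 ℤ.* (B ℤ.+ (z ℤ.+ δ)) ℤ.- τ → y ∈ℤ A
  other {z} z∈X refl = others (z ℤ.+ δ) (∩-right {E} {δ} {S} z∈X)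

  sum₁ : ∀ B x d → (B ℤ.+ x ℤ.+ + 2 ℤ.* + 0) ℤ.+ (B ℤ.+ x ℤ.+ + 2 ℤ.* d) ≡ + 2 ℤ.* (B ℤ.+ (x ℤ.+ d))
  sum₁ = ℤSolver.solve-∀
  sum₂ : ∀ B x d e → (B ℤ.+ x ℤ.+ + 2 ℤ.* d) ℤ.+ (B ℤ.+ x ℤ.+ + 2 ℤ.* e) ≡ + 2 ℤ.* (B ℤ.+ (x ℤ.+ e ℤ.+ d))
  sum₂ = ℤSolver.solve-∀
  sum₃ : ∀ B x δ τ → (B ℤ.+ x ℤ.+ + 2 ℤ.* + 0) ℤ.+ (B ℤ.+ x ℤ.+ (+ 2 ℤ.* δ ℤ.- τ)) ≡ + 2 ℤ.* (B ℤ.+ (x ℤ.+ δ)) ℤ.- τ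
  sum₃ = ℤSolver.solve-∀
  sum₄ : ∀ B x d δ τ → (B ℤ.+ x ℤ.+ + 2 ℤ.* d) ℤ.+ (B ℤ.+ x ℤ.+ (+ 2 ℤ.* δ ℤ.- τ)) ≡ + 2 ℤ.* (B ℤ.+ (x ℤ.+ d ℤ.+ δ)) ℤ.- τ
  sum₄ = ℤSolver.solve-∀

-- Both dense cases at once: `τ = 0` reads `S` through even elements, `τ = 1` through odd ones.
-- Forbidding 0 for `δ`, then 0 and `δ` for the sides, serves distinctness; it costs the 1 in
-- `♯ S m ∸ 1` and enters the factors 2, 3, 5 of the size hypotheses.
denseClique : ∀ (A : List ℕ) (B τ : ℤ) (E S : Pred) →
  (∀ z → E z ≡ true → (+ 2 ℤ.* (B ℤ.+ z)) ∈ℤ A) →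
  (∀ z → S z ≡ true → (+ 2 ℤ.* (B ℤ.+ z) ℤ.- τ) ∈ℤ A) →
  (∀ {δ d} → δ ≢ d → + 2 ℤ.* d ≢ + 2 ℤ.* δ ℤ.- τ) →
  ∀ m a → 0 < m → a * (suc a * 2) ≤ m → next a * (suc (next a) * 3) ≤ m → next (next a) * 5 ≤ m →
  0 < ♯ E m * (♯ S m ∸ 1) →
  (∀ n → ♯ E m * (♯ S m ∸ 1) ≤ (m + m) * n → m ≤ a * n) →
  HasSumClique 5 A
denseClique A B τ E S evens others τ-distinct m a 0<m large₁ large₂ large₃ positive dense =
  let δ , δ∉ , popular = popularDifference m E S (+ 0 ∷ []) positive
      x , d , e , f , d∉ , e∉ , f∉ , X-cube =
        threeCube a (E ∩[ δ ] S) (+ 0 ∷ δ ∷ []) 0<m large₁ large₂ large₃ (dense _ popular)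
  in cube⇒sumClique A B τ E S evens others τ-distinct δ∉ d∉ e∉ f∉ X-cube

-- Parity and pigeonhole principles.

double≢double-1 : ∀ a b → + 2 ℤ.* a ≢ + 2 ℤ.* b ℤ.- + 1
double≢double-1 a b eq = even≢odd ℤ.∣ b ℤ.- a ∣ 0 (trans (sym (ℤ.abs-* (+ 2) (b ℤ.- a))) (cong ℤ.∣_∣ (begin
  + 2 ℤ.* (b ℤ.- a)                                  ≡⟨ expand a b ⟩
  (+ 2 ℤ.* b ℤ.- + 1) ℤ.- + 2 ℤ.* a ℤ.+ + 1         ≡⟨ cong (λ z → z ℤ.- + 2 ℤ.* a ℤ.+ + 1) eq ⟨
  + 2 ℤ.* a ℤ.- + 2 ℤ.* a ℤ.+ + 1                   ≡⟨ collapse a ⟩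
  + 1                                                ∎)))
  where
  open ≡-Reasoning
  expand : ∀ a b → + 2 ℤ.* (b ℤ.- a) ≡ (+ 2 ℤ.* b ℤ.- + 1) ℤ.- + 2 ℤ.* a ℤ.+ + 1
  expand = ℤSolver.solve-∀
  collapse : ∀ a → + 2 ℤ.* a ℤ.- + 2 ℤ.* a ℤ.+ + 1 ≡ + 1
  collapse = ℤSolver.solve-∀

-- Equal summands would make the sum even. In the sparse case this separates `x`, `y`, `z` from `u`,
-- `v` with no further condition on `t`.
oddSum⇒≢ : ∀ {x y} c → x ℤ.+ y ≡ + 2 ℤ.* c ℤ.- + 1 → x ≢ y
oddSum⇒≢ {x} c eq refl = double≢double-1 x c (trans (double x) eq)
  where
  double : ∀ x → + 2 ℤ.* x ≡ x ℤ.+ x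
  double = ℤSolver.solve-∀

complement : Pred → Pred
complement D z = not (D z)

∑-vanishing : ∀ n (f : ℕ → ℕ) → ∑ n f < n → ∃[ i ] i < n × f i ≡ 0
∑-vanishing (suc n) f ∑<n with f n in fn
... | zero  = n , ≤-refl , fn
... | suc k with ∑-vanishing n f (≤-trans (s≤s (m≤m+n _ k)) (≤-trans (≤-reflexive (sym (+-suc _ k))) (s≤s⁻¹ ∑<n)))
...   | i , i<n , fi≡0 = i , m<n⇒m<1+n i<n , fi≡0

∑-pigeonhole : ∀ n (f : ℕ → ℕ) t → n * t < ∑ n f → ∃[ i ] i < n × t < f i
∑-pigeonhole (suc n) f t nt<∑ with t <? f n
... | yes t<fn = n , ≤-refl , t<fn
... | no  t≮fn with ∑-pigeonhole n f t (+-cancelˡ-< t _ _ (<-≤-trans nt<∑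
                      (≤-trans (+-monoʳ-≤ (∑ n f) (≮⇒≥ t≮fn)) (≤-reflexive (+-comm (∑ n f) t)))))
...   | i , i<n , t<fi = i , m<n⇒m<1+n i<n , t<fi

∑-blocks : ∀ k ℓ (f : ℕ → ℕ) → ∑ (k * ℓ) f ≡ ∑ k (λ w → ∑ ℓ (λ i → f (w * ℓ + i)))
∑-blocks zero    ℓ f = refl
∑-blocks (suc k) ℓ f = begin
  ∑ (ℓ + k * ℓ) f                               ≡⟨ cong (λ n → ∑ n f) (+-comm ℓ (k * ℓ)) ⟩
  ∑ (k * ℓ + ℓ) f                               ≡⟨ ∑-split (k * ℓ) ℓ f ⟩
  ∑ (k * ℓ) f + ∑ ℓ (λ i → f (k * ℓ + i))       ≡⟨ cong (_+ ∑ ℓ (λ i → f (k * ℓ + i))) (∑-blocks k ℓ f) ⟩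
  ∑ (suc k) (λ w → ∑ ℓ (λ i → f (w * ℓ + i)))   ∎
  where open ≡-Reasoning

-- All other hits lie below the last one. Repeated on the segment below it, this extracts hits in
-- decreasing order.
∑-last : ∀ n (p : ℕ → Bool) t → t < ∑ n (⟦_⟧ ∘ p) → ∃[ i ] i < n × p i ≡ true × t ≤ ∑ i (⟦_⟧ ∘ p)
∑-last (suc n) p t t<∑ with p n in pn
... | true  = n , ≤-refl , pn , s≤s⁻¹ (≤-trans t<∑ (≤-reflexive (+-comm _ 1)))
... | false with ∑-last n p t (≤-trans t<∑ (≤-reflexive (+-identityʳ _)))
...   | i , i<n , pi , t≤ = i , m<n⇒m<1+n i<n , pi , t≤

-- Cross sums of the sparse case.

-- With t = 2j + 1 + π, these are the indices of the odd numbers c + t and c − t as j varies.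
∑-twoRuns : ∀ a J π {m} (f : ℕ → ℕ) → a + J + π + J ≤ m →
  ∑ J (λ j → f (a + J + π + j) + f (a + (J ∸ suc j))) ≤ ∑ m f
∑-twoRuns a J π {m} f fits = begin
  ∑ J (λ j → f (a + J + π + j) + f (a + (J ∸ suc j)))                ≡⟨ ∑-+ J _ _ ⟩
  ∑ J (λ j → f (a + J + π + j)) + ∑ J (λ j → f (a + (J ∸ suc j)))    ≡⟨ cong (λ z → ∑ J (λ j → f (a + J + π + j)) + z) (∑-reverse J (λ i → f (a + i))) ⟩
  ∑ J (λ j → f (a + J + π + j)) + ∑ J (λ i → f (a + i))              ≡⟨ +-comm (∑ J (λ j → f (a + J + π + j))) _ ⟩
  ∑ J (λ i → f (a + i)) + ∑ J (λ j → f (a + J + π + j))              ≤⟨ +-monoˡ-≤ _ (∑-segment a J f (m≤m+n (a + J) π)) ⟩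
  ∑ (a + J + π) f + ∑ J (λ j → f (a + J + π + j))                    ≡⟨ ∑-split (a + J + π) J f ⟨
  ∑ (a + J + π + J) f                                                ≤⟨ ∑-segment 0 (a + J + π + J) f fits ⟩
  ∑ m f                                                              ∎
  where open ≤-Reasoning

-- `B + σ - ρ` is one of `x`, `y`, `z`, with `σ` the sum of the other two indices, and the second
-- summand is `u` with `t = 1 + 2j + π`. The sum is `2(B + κ + 1 - ρ + j) - 1`, and `a` is chosen so
-- that `κ + 1 - ρ = a + J + π`.
crossing⁺ : ∀ B σ ρ s π κ a J j → σ ℤ.+ ρ ℤ.+ s ℤ.+ π ≡ κ ℤ.+ κ → a ℤ.+ ρ ℤ.+ π ℤ.+ J ≡ + 1 ℤ.+ κ →
  (B ℤ.+ σ ℤ.- ρ) ℤ.+ (B ℤ.+ s ℤ.+ (+ 1 ℤ.+ (j ℤ.+ j ℤ.+ π))) ≡ + 2 ℤ.* (B ℤ.+ (a ℤ.+ J ℤ.+ π ℤ.+ j)) ℤ.- + 1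
crossing⁺ B σ ρ s π κ a J j sum offset = begin
  (B ℤ.+ σ ℤ.- ρ) ℤ.+ (B ℤ.+ s ℤ.+ (+ 1 ℤ.+ (j ℤ.+ j ℤ.+ π)))
    ≡⟨ lhs B σ ρ s π j ⟩
  + 2 ℤ.* B ℤ.+ (σ ℤ.+ ρ ℤ.+ s ℤ.+ π) ℤ.- + 2 ℤ.* ρ ℤ.+ + 1 ℤ.+ + 2 ℤ.* j
    ≡⟨ cong (λ z → + 2 ℤ.* B ℤ.+ z ℤ.- + 2 ℤ.* ρ ℤ.+ + 1 ℤ.+ + 2 ℤ.* j) sum ⟩
  + 2 ℤ.* B ℤ.+ (κ ℤ.+ κ) ℤ.- + 2 ℤ.* ρ ℤ.+ + 1 ℤ.+ + 2 ℤ.* j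
    ≡⟨ middle B ρ κ j ⟩
  + 2 ℤ.* B ℤ.+ + 2 ℤ.* (+ 1 ℤ.+ κ) ℤ.- + 2 ℤ.* ρ ℤ.- + 1 ℤ.+ + 2 ℤ.* j
    ≡⟨ cong (λ z → + 2 ℤ.* B ℤ.+ + 2 ℤ.* z ℤ.- + 2 ℤ.* ρ ℤ.- + 1 ℤ.+ + 2 ℤ.* j) offset ⟨
  + 2 ℤ.* B ℤ.+ + 2 ℤ.* (a ℤ.+ ρ ℤ.+ π ℤ.+ J) ℤ.- + 2 ℤ.* ρ ℤ.- + 1 ℤ.+ + 2 ℤ.* j
    ≡⟨ rhs B ρ π a J j ⟩
  + 2 ℤ.* (B ℤ.+ (a ℤ.+ J ℤ.+ π ℤ.+ j)) ℤ.- + 1 ∎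
  where
  open ≡-Reasoning
  lhs : ∀ B σ ρ s π j → (B ℤ.+ σ ℤ.- ρ) ℤ.+ (B ℤ.+ s ℤ.+ (+ 1 ℤ.+ (j ℤ.+ j ℤ.+ π))) ≡
    + 2 ℤ.* B ℤ.+ (σ ℤ.+ ρ ℤ.+ s ℤ.+ π) ℤ.- + 2 ℤ.* ρ ℤ.+ + 1 ℤ.+ + 2 ℤ.* j
  lhs = ℤSolver.solve-∀
  middle : ∀ B ρ κ j → + 2 ℤ.* B ℤ.+ (κ ℤ.+ κ) ℤ.- + 2 ℤ.* ρ ℤ.+ + 1 ℤ.+ + 2 ℤ.* j ≡
    + 2 ℤ.* B ℤ.+ + 2 ℤ.* (+ 1 ℤ.+ κ) ℤ.- + 2 ℤ.* ρ ℤ.- + 1 ℤ.+ + 2 ℤ.* j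
  middle = ℤSolver.solve-∀
  rhs : ∀ B ρ π a J j → + 2 ℤ.* B ℤ.+ + 2 ℤ.* (a ℤ.+ ρ ℤ.+ π ℤ.+ J) ℤ.- + 2 ℤ.* ρ ℤ.- + 1 ℤ.+ + 2 ℤ.* j ≡
    + 2 ℤ.* (B ℤ.+ (a ℤ.+ J ℤ.+ π ℤ.+ j)) ℤ.- + 1
  rhs = ℤSolver.solve-∀

-- Passing from `+t` to `-t` lowers the sum by `2t`, hence the index by `t`: from `a + J + π + j` to
-- `a + (J - 1 - j)`.
crossing⁻ : ∀ B σ ρ s π κ a J j J′ → σ ℤ.+ ρ ℤ.+ s ℤ.+ π ≡ κ ℤ.+ κ → a ℤ.+ ρ ℤ.+ π ℤ.+ J ≡ + 1 ℤ.+ κ →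
  + 1 ℤ.+ j ℤ.+ J′ ≡ J →
  (B ℤ.+ σ ℤ.- ρ) ℤ.+ (B ℤ.+ s ℤ.- (+ 1 ℤ.+ (j ℤ.+ j ℤ.+ π))) ≡ + 2 ℤ.* (B ℤ.+ (a ℤ.+ J′)) ℤ.- + 1
crossing⁻ B σ ρ s π κ a _ j J′ sum offset refl = begin
  (B ℤ.+ σ ℤ.- ρ) ℤ.+ (B ℤ.+ s ℤ.- (+ 1 ℤ.+ (j ℤ.+ j ℤ.+ π)))
    ≡⟨ step₁ (B ℤ.+ σ ℤ.- ρ) (B ℤ.+ s) (+ 1 ℤ.+ (j ℤ.+ j ℤ.+ π)) ⟩
  (B ℤ.+ σ ℤ.- ρ) ℤ.+ (B ℤ.+ s ℤ.+ (+ 1 ℤ.+ (j ℤ.+ j ℤ.+ π))) ℤ.- + 2 ℤ.* (+ 1 ℤ.+ (j ℤ.+ j ℤ.+ π))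
    ≡⟨ cong (ℤ._- + 2 ℤ.* (+ 1 ℤ.+ (j ℤ.+ j ℤ.+ π))) (crossing⁺ B σ ρ s π κ a (+ 1 ℤ.+ j ℤ.+ J′) j sum offset) ⟩
  + 2 ℤ.* (B ℤ.+ (a ℤ.+ (+ 1 ℤ.+ j ℤ.+ J′) ℤ.+ π ℤ.+ j)) ℤ.- + 1 ℤ.- + 2 ℤ.* (+ 1 ℤ.+ (j ℤ.+ j ℤ.+ π))
    ≡⟨ step₂ B π a j J′ ⟩
  + 2 ℤ.* (B ℤ.+ (a ℤ.+ J′)) ℤ.- + 1 ∎
  where
  open ≡-Reasoning
  step₁ : ∀ x y t → x ℤ.+ (y ℤ.- t) ≡ x ℤ.+ (y ℤ.+ t) ℤ.- + 2 ℤ.* t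
  step₁ = ℤSolver.solve-∀
  step₂ : ∀ B π a j J′ →
    + 2 ℤ.* (B ℤ.+ (a ℤ.+ (+ 1 ℤ.+ j ℤ.+ J′) ℤ.+ π ℤ.+ j)) ℤ.- + 1 ℤ.- + 2 ℤ.* (+ 1 ℤ.+ (j ℤ.+ j ℤ.+ π)) ≡
    + 2 ℤ.* (B ℤ.+ (a ℤ.+ J′)) ℤ.- + 1
  step₂ = ℤSolver.solve-∀

-- `x`, `y`, `z` share the total `ρ + σ`; subtracting each from `B` plus that total recovers its
-- `2ρ`.
differ : ∀ B σ ρ σ′ ρ′ → ρ + σ ≡ ρ′ + σ′ → ρ ≢ ρ′ → B ℤ.+ + σ ℤ.- + ρ ≢ B ℤ.+ + σ′ ℤ.- + ρ′
differ B σ ρ σ′ ρ′ sums ρ≢ρ′ eq = ρ≢ρ′ (ℤ.+-injective (ℤ.*-cancelˡ-≡ (+ 2) (+ ρ) (+ ρ′) (begin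
  + 2 ℤ.* + ρ                                            ≡⟨ recover B (+ σ) (+ ρ) ⟩
  (B ℤ.+ + (ρ + σ)) ℤ.- (B ℤ.+ + σ ℤ.- + ρ)              ≡⟨ cong₂ (λ a b → (B ℤ.+ + a) ℤ.- b) sums eq ⟩
  (B ℤ.+ + (ρ′ + σ′)) ℤ.- (B ℤ.+ + σ′ ℤ.- + ρ′)          ≡⟨ recover B (+ σ′) (+ ρ′) ⟨
  + 2 ℤ.* + ρ′                                           ∎)))
  where
  open ≡-Reasoning
  recover : ∀ B σ ρ → + 2 ℤ.* ρ ≡ (B ℤ.+ (ρ ℤ.+ σ)) ℤ.- (B ℤ.+ σ ℤ.- ρ)
  recover = ℤSolver.solve-∀

+≢- : ∀ c n → c ℤ.+ + suc n ≢ c ℤ.- + suc n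
+≢- c n eq with ℤ+.∙-cancelˡ c _ _ eq
... | ()

⟦not⟧≡0 : ∀ {b} → ⟦ not b ⟧ ≡ 0 → b ≡ true
⟦not⟧≡0 {true} _ = refl

-- κ is half of p + q + r + s + π; for each ρ among p, q, r the J choices of t must give cross
-- sums inside the window.
Crossing : (m J π κ ρ : ℕ) → Set
Crossing m J π κ ρ = ∃[ a ] a + ρ + π + J ≡ suc κ × a + J + π + J ≤ m

-- The two equations give `2a = σ - ρ + s - π + 2 - 2J`. The worst case for the lower end is
-- `σ = 2c`, `ρ = c + ℓ`, `π = 1`, where `low` says exactly that this is nonnegative. The worst case
-- for the upper end is `σ = 2(c + ℓ)`, `ρ = c`, `π = 1`, where `2(a + 2J + π)` becomes the left
-- side of `high`.
crossing : ∀ {m J ℓ c} σ ρ s π κ → π ≤ 1 → c ≤ ρ → ρ ≤ c + ℓ → c + c ≤ σ → σ ≤ (c + ℓ) + (c + ℓ) →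
  σ + ρ + s + π ≡ κ + κ →
  c + 2 * ℓ + s + 3 + 2 * J ≤ 2 * m → ℓ + 2 * J ≤ c + s + 1 → Crossing m J π κ ρ
crossing {m} {J} {ℓ} {c} σ ρ s π κ π≤1 c≤ρ ρ≤c+ℓ 2c≤σ σ≤2c+2ℓ sum high low
  with m≤n⇒∃[o]m+o≡n (*-cancelˡ-≤ {ρ + π + J} {suc κ} 2 lower)
  where
  open ≤-Reasoning
  e₁ : ∀ ρ π J → 2 * (ρ + π + J) ≡ ρ + π + (ρ + π + 2 * J)
  e₁ = ℕSolver.solve-∀
  e₂ : ∀ c ℓ J ρ π → ρ + π + (c + ℓ + 1 + 2 * J) ≡ ρ + π + (c + 1 + (ℓ + 2 * J))
  e₂ = ℕSolver.solve-∀
  e₃ : ∀ c s ρ π → ρ + π + (c + 1 + (c + s + 1)) ≡ c + c + (ρ + s + π + 2)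
  e₃ = ℕSolver.solve-∀
  e₄ : ∀ σ ρ s π → σ + (ρ + s + π + 2) ≡ σ + ρ + s + π + 2
  e₄ = ℕSolver.solve-∀
  e₅ : ∀ κ → κ + κ + 2 ≡ 2 * suc κ
  e₅ = ℕSolver.solve-∀
  lower : 2 * (ρ + π + J) ≤ 2 * suc κ
  lower = begin
    2 * (ρ + π + J)                        ≡⟨ e₁ ρ π J ⟩
    ρ + π + (ρ + π + 2 * J)                ≤⟨ +-monoʳ-≤ (ρ + π) (+-monoˡ-≤ (2 * J) (+-mono-≤ ρ≤c+ℓ π≤1)) ⟩
    ρ + π + (c + ℓ + 1 + 2 * J)            ≡⟨ e₂ c ℓ J ρ π ⟩
    ρ + π + (c + 1 + (ℓ + 2 * J))          ≤⟨ +-monoʳ-≤ (ρ + π) (+-monoʳ-≤ (c + 1) low) ⟩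
    ρ + π + (c + 1 + (c + s + 1))          ≡⟨ e₃ c s ρ π ⟩
    c + c + (ρ + s + π + 2)                ≤⟨ +-monoˡ-≤ (ρ + s + π + 2) 2c≤σ ⟩
    σ + (ρ + s + π + 2)                    ≡⟨ e₄ σ ρ s π ⟩
    σ + ρ + s + π + 2                      ≡⟨ cong (_+ 2) sum ⟩
    κ + κ + 2                              ≡⟨ e₅ κ ⟩
    2 * suc κ                              ∎
... | a , a-def = a , offset , +-cancelˡ-≤ ρ _ _ (*-cancelˡ-≤ 2 upper)
  where
  open ≤-Reasoning
  commute : ∀ a ρ π J → a + ρ + π + J ≡ ρ + π + J + a
  commute = ℕSolver.solve-∀
  offset : a + ρ + π + J ≡ suc κ
  offset = trans (commute a ρ π J) a-def
  e₁ : ∀ a ρ π J → 2 * (ρ + (a + J + π + J)) ≡ 2 * (a + ρ + π + J) + 2 * J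
  e₁ = ℕSolver.solve-∀
  e₂ : ∀ κ J → 2 * suc κ + 2 * J ≡ κ + κ + (2 + 2 * J)
  e₂ = ℕSolver.solve-∀
  e₃ : ∀ c ℓ J ρ s → c + ℓ + (c + ℓ) + ρ + s + 1 + (2 + 2 * J) ≡ ρ + c + (c + 2 * ℓ + s + 3 + 2 * J)
  e₃ = ℕSolver.solve-∀
  e₄ : ∀ ρ m → ρ + ρ + 2 * m ≡ 2 * (ρ + m)
  e₄ = ℕSolver.solve-∀
  upper : 2 * (ρ + (a + J + π + J)) ≤ 2 * (ρ + m)
  upper = begin
    2 * (ρ + (a + J + π + J))                    ≡⟨ e₁ a ρ π J ⟩
    2 * (a + ρ + π + J) + 2 * J                  ≡⟨ cong (λ z → 2 * z + 2 * J) offset ⟩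
    2 * suc κ + 2 * J                            ≡⟨ e₂ κ J ⟩
    κ + κ + (2 + 2 * J)                          ≡⟨ cong (_+ (2 + 2 * J)) sum ⟨
    σ + ρ + s + π + (2 + 2 * J)                  ≤⟨ +-monoˡ-≤ (2 + 2 * J) (+-mono-≤ (+-monoˡ-≤ s (+-monoˡ-≤ ρ σ≤2c+2ℓ)) π≤1) ⟩
    c + ℓ + (c + ℓ) + ρ + s + 1 + (2 + 2 * J)    ≡⟨ e₃ c ℓ J ρ s ⟩
    ρ + c + (c + 2 * ℓ + s + 3 + 2 * J)          ≤⟨ +-mono-≤ (+-monoʳ-≤ ρ c≤ρ) high ⟩
    ρ + ρ + 2 * m                                ≡⟨ e₄ ρ m ⟩
    2 * (ρ + m)                                  ∎

-- Parity correction, crowded blocks and trimming.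

halve : ∀ n → ∃[ i ] (n ≡ i + i ⊎ n ≡ suc (i + i))
halve zero    = 0 , inj₁ refl
halve (suc n) with halve n
... | i , inj₁ refl = i , inj₂ refl
... | i , inj₂ refl = suc i , inj₁ (cong suc (sym (+-suc i i)))

-- `π` is the parity of `n`. For `n = p + q + r + s` it also enters `t = 2j + 1 + π`, which makes
-- the six cross sums odd.
evenUp : ∀ n → ∃[ π ] ∃[ κ ] π ≤ 1 × n + π ≡ κ + κ
evenUp n with halve n
... | i , inj₁ refl = 0 , i , z≤n , +-identityʳ _
... | i , inj₂ refl = 1 , suc i , ≤-refl , cong suc (trans (+-comm (i + i) 1) (sym (+-suc i i)))

-- More than `2k` members in `k` blocks put three into one block. The blocks may overrun `m`, which
-- can only add members.
crowdedWindow : ∀ k ℓ m (E : Pred) → m ≤ k * ℓ → k * 2 < ♯ E m →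
  ∃[ w ] w < k × ∃[ p ] ∃[ q ] ∃[ r ] p < q × q < r × r < ℓ ×
    E (+ (w * ℓ + p)) ≡ true × E (+ (w * ℓ + q)) ≡ true × E (+ (w * ℓ + r)) ≡ true
crowdedWindow k ℓ m E m≤kℓ crowded =
  let w , w<k , 3≤ = ∑-pigeonhole k _ 2 (≤-trans crowded (≤-trans (∑-segment 0 m (λ i → ⟦ E (+ i) ⟧) m≤kℓ)
                       (≤-reflexive (∑-blocks k ℓ (λ i → ⟦ E (+ i) ⟧)))))
      p? = λ i → E (+ (w * ℓ + i))
      r , r<ℓ , Er , 2≤ = ∑-last ℓ p? 2 3≤
      q , q<r , Eq , 1≤ = ∑-last r p? 1 2≤
      p , p<q , Ep , _  = ∑-last q p? 0 1≤
  in w , w<k , p , q , r , p<q , q<r , r<ℓ , Ep , Eq , Er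

-- Dropping an end index outside `e` keeps the `e` count and can only lower the `o` count, so the
-- surplus survives. As `C` is positive, the window never becomes empty.
trim : ∀ n C (e o : ℕ → Bool) → 0 < C → ∑ n (⟦_⟧ ∘ o) + C ≤ ∑ n (⟦_⟧ ∘ e) →
  ∃[ lo ] ∃[ k ] e lo ≡ true × e (lo + k) ≡ true ×
    ∑ (suc k) (λ i → ⟦ o (lo + i) ⟧) + C ≤ ∑ (suc k) (λ i → ⟦ e (lo + i) ⟧)
trim zero    C e o 0<C C≤0 = contradiction (≤-trans 0<C C≤0) λ ()
trim (suc n) C e o 0<C gain with e n in en
... | false = trim n C e o 0<C (≤-trans (+-monoˡ-≤ C (m≤m+n _ ⟦ o n ⟧)) (≤-trans gain (≤-reflexive (+-identityʳ _))))
... | true with e 0 in e0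
...   | true  = 0 , n , e0 , en , ≤-trans gain (≤-reflexive (cong (λ b → ∑ n (⟦_⟧ ∘ e) + ⟦ b ⟧) (sym en)))
...   | false with trim n C (e ∘ suc) (o ∘ suc) 0<C (begin
    ∑ n (⟦_⟧ ∘ o ∘ suc) + C                  ≤⟨ +-monoˡ-≤ C (∑-segment 1 n (⟦_⟧ ∘ o) ≤-refl) ⟩
    ∑ (suc n) (⟦_⟧ ∘ o) + C                  ≤⟨ gain ⟩
    ∑ n (⟦_⟧ ∘ e) + 1                        ≡⟨ cong (λ b → ∑ n (⟦_⟧ ∘ e) + ⟦ b ⟧) en ⟨
    ∑ (1 + n) (⟦_⟧ ∘ e)                      ≡⟨ ∑-split 1 n (⟦_⟧ ∘ e) ⟩
    ⟦ e 0 ⟧ + ∑ n (⟦_⟧ ∘ e ∘ suc)            ≡⟨ cong (λ b → ⟦ b ⟧ + ∑ n (⟦_⟧ ∘ e ∘ suc)) e0 ⟩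
    ∑ n (⟦_⟧ ∘ e ∘ suc)                      ∎)
  where open ≤-Reasoning
...     | lo , k , elo , elok , gain′ = suc lo , k , elo , elok , gain′

-- Comparing the length of a list with counts of its values.

∑-mono-< : ∀ n {f g : ℕ → ℕ} {i} → (∀ i → f i ≤ g i) → i < n → f i < g i → ∑ n f < ∑ n g
∑-mono-< (suc n) {f} {g} {i} f≤g i<1+n fi<gi with m≤n⇒m<n∨m≡n (s≤s⁻¹ i<1+n)
... | inj₁ i<n  = +-mono-<-≤ (∑-mono-< n f≤g i<n fi<gi) (f≤g n)
... | inj₂ refl = +-mono-≤-< (∑-mono n λ i _ → f≤g i) fi<gi

occurs : List ℤ → ℤ → ℕ
occurs xs z = ⟦ does (z ∈? xs) ⟧

-- By uniqueness, each new entry `x` turns `occurs` from 0 to 1 at some `g i` or `g′ i` and lowers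
-- it nowhere, so the right side grows by at least 1.
length≤∑ : ∀ n (g g′ : ℕ → ℤ) (xs : List ℤ) → List.Unique xs →
  All (λ x → ∃[ i ] i < n × (x ≡ g i ⊎ x ≡ g′ i)) xs →
  length xs ≤ ∑ n (λ i → occurs xs (g i)) + ∑ n (λ i → occurs xs (g′ i))
length≤∑ n g g′ [] _ _ = z≤n
length≤∑ n g g′ (x ∷ xs) (x# AllPairs.∷ unique) ((i , i<n , x≡) All.∷ covered) =
  ≤-trans (s≤s (length≤∑ n g g′ xs unique covered)) (increase x≡)
  where
  weaken : ∀ z → occurs xs z ≤ occurs (x ∷ xs) z
  weaken z with does (z ℤ.≟ x)
  ... | false = ≤-refl
  ... | true  = ⟦⟧≤1 _

  strict : ∀ {z} → x ≡ z → occurs xs z < occurs (x ∷ xs) z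
  strict refl = subst₂ _<_ (sym (cong ⟦_⟧ (dec-false (x ∈? xs) λ x∈xs → All.lookup x# x∈xs refl)))
    (sym (cong ⟦_⟧ (dec-true (x ∈? (x ∷ xs)) (here refl)))) (≤-refl {1})

  increase : x ≡ g i ⊎ x ≡ g′ i →
    ∑ n (λ i → occurs xs (g i)) + ∑ n (λ i → occurs xs (g′ i)) <
    ∑ n (λ i → occurs (x ∷ xs) (g i)) + ∑ n (λ i → occurs (x ∷ xs) (g′ i))
  increase (inj₁ x≡gi)  = +-mono-<-≤ (∑-mono-< n (weaken ∘ g) i<n (strict x≡gi)) (∑-mono n λ i _ → weaken (g′ i))
  increase (inj₂ x≡g′i) = +-mono-≤-< (∑-mono n λ i _ → weaken (g i)) (∑-mono-< n (weaken ∘ g′) i<n (strict x≡g′i))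

♯≤m : ∀ P m → ♯ P m ≤ m
♯≤m P m = ≤-trans (∑-mono m λ i _ → ⟦⟧≤1 (P (+ i))) (≤-reflexive (trans (∑-const m 1) (*-identityʳ m)))

⟦⟧-complement : ∀ b → ⟦ b ⟧ + ⟦ not b ⟧ ≡ 1
⟦⟧-complement true  = refl
⟦⟧-complement false = refl

♯-complement : ∀ D m → ♯ D m + ♯ (complement D) m ≡ m
♯-complement D m = begin
  ♯ D m + ♯ (complement D) m                        ≡⟨ ∑-+ m _ _ ⟨
  ∑ m (λ i → ⟦ D (+ i) ⟧ + ⟦ not (D (+ i)) ⟧)       ≡⟨ ∑-cong m (λ i _ → ⟦⟧-complement (D (+ i))) ⟩
  ∑ m (λ _ → 1)                                     ≡⟨ ∑-const m 1 ⟩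
  m * 1                                             ≡⟨ *-identityʳ m ⟩
  m                                                 ∎
  where open ≡-Reasoning

-- The sparse case.

module _ (A : List ℕ) (B : ℤ) (E D : Pred)
         (evens : ∀ z → E z ≡ true → (+ 2 ℤ.* (B ℤ.+ z)) ∈ℤ A)
         (odds : ∀ z → D z ≡ true → (+ 2 ℤ.* (B ℤ.+ z) ℤ.- + 1) ∈ℤ A) where

  -- `x`, `y`, `z` have pair sums `2(B + p)`, `2(B + q)`, `2(B + r)`, and `u + v = 2(B + s)`. For
  -- each of the three indices the two runs are disjoint, so a missing odd number blocks at most one
  -- `j`; fewer than `J` values are blocked in all.
  crossingClique : ∀ m J p q r s π κ →
    p ≢ q → p ≢ r → q ≢ r →
    E (+ p) ≡ true → E (+ q) ≡ true → E (+ r) ≡ true → E (+ s) ≡ true →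
    p + q + r + s + π ≡ κ + κ →
    Crossing m J π κ p → Crossing m J π κ q → Crossing m J π κ r →
    3 * ♯ (complement D) m < J → HasSumClique 5 A
  crossingClique m J p q r s π κ p≢q p≢r q≢r Ep Eq Er Es sum (aₚ , offₚ , fitₚ) (a_q , off_q , fit_q) (aᵣ , offᵣ , fitᵣ) few =
    sumClique A (x ∷ y ∷ z ∷ u ∷ v ∷ [])
      ( (differ B (p + q) r (p + r) q (rot₁ p q r) (q≢r ∘ sym) ∷ differ B (p + q) r (q + r) p (rot₂ p q r) (p≢r ∘ sym)
          ∷ oddSum⇒≢ (cross⁺ aᵣ) x+u ∷ oddSum⇒≢ (cross⁻ aᵣ) x+v ∷ [])
      ∷ (differ B (p + r) q (q + r) p (rot₃ p q r) (p≢q ∘ sym) ∷ oddSum⇒≢ (cross⁺ a_q) y+u ∷ oddSum⇒≢ (cross⁻ a_q) y+v ∷ [])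
      ∷ (oddSum⇒≢ (cross⁺ aₚ) z+u ∷ oddSum⇒≢ (cross⁻ aₚ) z+v ∷ [])
      ∷ (+≢- (B ℤ.+ + s) (j + j + π) ∷ [])
      ∷ [] ∷ [])
      ( (even Ep (inner₁ B (+ p) (+ q) (+ r)) ∷ even Eq (inner₂ B (+ p) (+ q) (+ r)) ∷ odd (D⁺ aᵣ zeroᵣ) x+u ∷ odd (D⁻ aᵣ zeroᵣ) x+v ∷ [])
      ∷ (even Er (inner₃ B (+ p) (+ q) (+ r)) ∷ odd (D⁺ a_q zero_q) y+u ∷ odd (D⁻ a_q zero_q) y+v ∷ [])
      ∷ (odd (D⁺ aₚ zeroₚ) z+u ∷ odd (D⁻ aₚ zeroₚ) z+v ∷ [])
      ∷ (even Es (inner₄ B (+ s) (+ suc (j + j + π))) ∷ [])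
      ∷ [] ∷ [])
    where
    missing : ℕ → ℕ
    missing i = ⟦ not (D (+ i)) ⟧

    blocked : ℕ → ℕ → ℕ
    blocked a j = missing (a + J + π + j) + missing (a + (J ∸ suc j))

    blocked-few : ∑ J (λ j → blocked aₚ j + blocked a_q j + blocked aᵣ j) < J
    blocked-few = begin-strict
      ∑ J (λ j → blocked aₚ j + blocked a_q j + blocked aᵣ j)
        ≡⟨ ∑-+ J (λ j → blocked aₚ j + blocked a_q j) (blocked aᵣ) ⟩
      ∑ J (λ j → blocked aₚ j + blocked a_q j) + ∑ J (blocked aᵣ)
        ≡⟨ cong (_+ ∑ J (blocked aᵣ)) (∑-+ J (blocked aₚ) (blocked a_q)) ⟩
      ∑ J (blocked aₚ) + ∑ J (blocked a_q) + ∑ J (blocked aᵣ)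
        ≤⟨ +-mono-≤ (+-mono-≤ (∑-twoRuns aₚ J π missing fitₚ) (∑-twoRuns a_q J π missing fit_q)) (∑-twoRuns aᵣ J π missing fitᵣ) ⟩
      N + N + N
        ≡⟨ triple N ⟩
      3 * N
        <⟨ few ⟩
      J ∎
      where
      open ≤-Reasoning
      N = ♯ (complement D) m
      triple : ∀ n → n + n + n ≡ 3 * n
      triple = ℕSolver.solve-∀

    choice : ∃[ j ] j < J × blocked aₚ j + blocked a_q j + blocked aᵣ j ≡ 0
    choice = ∑-vanishing J _ blocked-few

    j : ℕ
    j = proj₁ choice

    zeroᵣ : blocked aᵣ j ≡ 0
    zeroᵣ = m+n≡0⇒n≡0 (blocked aₚ j + blocked a_q j) (proj₂ (proj₂ choice))

    zero_q : blocked a_q j ≡ 0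
    zero_q = m+n≡0⇒n≡0 (blocked aₚ j) (m+n≡0⇒m≡0 _ (proj₂ (proj₂ choice)))

    zeroₚ : blocked aₚ j ≡ 0
    zeroₚ = m+n≡0⇒m≡0 _ (m+n≡0⇒m≡0 _ (proj₂ (proj₂ choice)))

    D⁺ : ∀ a → blocked a j ≡ 0 → D (+ (a + J + π + j)) ≡ true
    D⁺ a free = ⟦not⟧≡0 (m+n≡0⇒m≡0 _ free)

    D⁻ : ∀ a → blocked a j ≡ 0 → D (+ (a + (J ∸ suc j))) ≡ true
    D⁻ a free = ⟦not⟧≡0 (m+n≡0⇒n≡0 (missing (a + J + π + j)) free)

    cross⁺ cross⁻ : ℕ → ℤ
    cross⁺ a = B ℤ.+ + (a + J + π + j)
    cross⁻ a = B ℤ.+ + (a + (J ∸ suc j))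

    x y z u v : ℤ
    x = B ℤ.+ + (p + q) ℤ.- + r
    y = B ℤ.+ + (p + r) ℤ.- + q
    z = B ℤ.+ + (q + r) ℤ.- + p
    u = B ℤ.+ + s ℤ.+ + suc (j + j + π)
    v = B ℤ.+ + s ℤ.- + suc (j + j + π)

    even : ∀ {k w} → E (+ k) ≡ true → w ≡ + 2 ℤ.* (B ℤ.+ + k) → w ∈ℤ A
    even {k} Ek refl = evens (+ k) Ek

    odd : ∀ {k w} → D (+ k) ≡ true → w ≡ + 2 ℤ.* (B ℤ.+ + k) ℤ.- + 1 → w ∈ℤ A
    odd {k} Dk refl = odds (+ k) Dk

    plus : ∀ σ ρ a → σ + ρ + s + π ≡ κ + κ → a + ρ + π + J ≡ suc κ →
      (B ℤ.+ + σ ℤ.- + ρ) ℤ.+ u ≡ + 2 ℤ.* cross⁺ a ℤ.- + 1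
    plus σ ρ a sum off = crossing⁺ B (+ σ) (+ ρ) (+ s) (+ π) (+ κ) (+ a) (+ J) (+ j) (cong +_ sum) (cong +_ off)

    minus : ∀ σ ρ a → σ + ρ + s + π ≡ κ + κ → a + ρ + π + J ≡ suc κ →
      (B ℤ.+ + σ ℤ.- + ρ) ℤ.+ v ≡ + 2 ℤ.* cross⁻ a ℤ.- + 1
    minus σ ρ a sum off = crossing⁻ B (+ σ) (+ ρ) (+ s) (+ π) (+ κ) (+ a) (+ J) (+ j) (+ (J ∸ suc j))
      (cong +_ sum) (cong +_ off) (cong +_ (m+[n∸m]≡n (proj₁ (proj₂ choice))))

    sum_q : p + r + q + s + π ≡ κ + κ
    sum_q = trans (cong (λ n → n + s + π) (swap p q r)) sum
      where
      swap : ∀ p q r → p + r + q ≡ p + q + r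
      swap = ℕSolver.solve-∀

    sumₚ : q + r + p + s + π ≡ κ + κ
    sumₚ = trans (cong (λ n → n + s + π) (swap p q r)) sum
      where
      swap : ∀ p q r → q + r + p ≡ p + q + r
      swap = ℕSolver.solve-∀

    x+u = plus (p + q) r aᵣ sum offᵣ
    x+v = minus (p + q) r aᵣ sum offᵣ
    y+u = plus (p + r) q a_q sum_q off_q
    y+v = minus (p + r) q a_q sum_q off_q
    z+u = plus (q + r) p aₚ sumₚ offₚ
    z+v = minus (q + r) p aₚ sumₚ offₚ

    rot₁ : ∀ p q r → r + (p + q) ≡ q + (p + r)
    rot₁ = ℕSolver.solve-∀
    rot₂ : ∀ p q r → r + (p + q) ≡ p + (q + r)
    rot₂ = ℕSolver.solve-∀
    rot₃ : ∀ p q r → q + (p + r) ≡ p + (q + r)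
    rot₃ = ℕSolver.solve-∀

    inner₁ : ∀ B p q r → (B ℤ.+ (p ℤ.+ q) ℤ.- r) ℤ.+ (B ℤ.+ (p ℤ.+ r) ℤ.- q) ≡ + 2 ℤ.* (B ℤ.+ p)
    inner₁ = ℤSolver.solve-∀
    inner₂ : ∀ B p q r → (B ℤ.+ (p ℤ.+ q) ℤ.- r) ℤ.+ (B ℤ.+ (q ℤ.+ r) ℤ.- p) ≡ + 2 ℤ.* (B ℤ.+ q)
    inner₂ = ℤSolver.solve-∀
    inner₃ : ∀ B p q r → (B ℤ.+ (p ℤ.+ r) ℤ.- q) ℤ.+ (B ℤ.+ (q ℤ.+ r) ℤ.- p) ≡ + 2 ℤ.* (B ℤ.+ r)
    inner₃ = ℤSolver.solve-∀
    inner₄ : ∀ B s t → (B ℤ.+ s ℤ.+ t) ℤ.+ (B ℤ.+ s ℤ.- t) ≡ + 2 ℤ.* (B ℤ.+ s)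
    inner₄ = ℤSolver.solve-∀

  windowClique : ∀ m J ℓ c s p q r → p < q → q < r → r < ℓ →
    E (+ (c + p)) ≡ true → E (+ (c + q)) ≡ true → E (+ (c + r)) ≡ true → E (+ s) ≡ true →
    c + 2 * ℓ + s + 3 + 2 * J ≤ 2 * m → ℓ + 2 * J ≤ c + s + 1 →
    3 * ♯ (complement D) m < J → HasSumClique 5 A
  windowClique m J ℓ c s p q r p<q q<r r<ℓ Ep Eq Er Es high low few =
    let p′ = c + p
        q′ = c + q
        r′ = c + r
        π , κ , π≤1 , sum = evenUp (p′ + q′ + r′ + s)
    in crossingClique m J p′ q′ r′ s π κ
      (<⇒≢ (+-monoʳ-< c p<q)) (<⇒≢ (+-monoʳ-< c (<-trans p<q q<r))) (<⇒≢ (+-monoʳ-< c q<r))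
      Ep Eq Er Es sum
      (near (q′ + r′) p′ s π κ π≤1 (at p) (below p p<ℓ) (both q r) (belows q r q<ℓ r<ℓ) (trans (cong (λ n → n + s + π) (rot p′ q′ r′)) sum) high low)
      (near (p′ + r′) q′ s π κ π≤1 (at q) (below q q<ℓ) (both p r) (belows p r p<ℓ r<ℓ) (trans (cong (λ n → n + s + π) (swap p′ q′ r′)) sum) high low)
      (near (p′ + q′) r′ s π κ π≤1 (at r) (below r r<ℓ) (both p q) (belows p q p<ℓ q<ℓ) sum high low)
      few
    where
    near = crossing {m} {J} {ℓ} {c}
    q<ℓ = <-trans q<r r<ℓ
    p<ℓ = <-trans p<q q<ℓ
    at : ∀ i → c ≤ c + i
    at i = m≤m+n c i
    below : ∀ i → i < ℓ → c + i ≤ c + ℓ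
    below i i<ℓ = +-monoʳ-≤ c (<⇒≤ i<ℓ)
    both : ∀ i j → c + c ≤ c + i + (c + j)
    both i j = +-mono-≤ (at i) (at j)
    belows : ∀ i j → i < ℓ → j < ℓ → c + i + (c + j) ≤ c + ℓ + (c + ℓ)
    belows i j i<ℓ j<ℓ = +-mono-≤ (below i i<ℓ) (below j j<ℓ)
    rot : ∀ p q r → q + r + p ≡ p + q + r
    rot = ℕSolver.solve-∀
    swap : ∀ p q r → p + r + q ≡ p + q + r
    swap = ℕSolver.solve-∀

  -- There are 16 blocks of length `ℓ = 2h + 2`, so more than 32 members of `E` crowd one of them.
  -- The relation between `J` and `h` makes `9ℓ + 2 + 2J` equal to `32h`, just what fits when the
  -- three indices lie in the first eight blocks.
  sparseClique : ∀ k h J → 2 ≤ h → 32 * h ≤ suc k → suc k ≤ 16 * (2 * h + 2) → J + 10 ≡ 7 * h →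
    E (+ 0) ≡ true → E (+ k) ≡ true → 32 < ♯ E (suc k) → 3 * ♯ (complement D) (suc k) < J →
    HasSumClique 5 A
  sparseClique k h J 2≤h 32h≤m m≤16ℓ J+10≡7h E-first E-last many few =
    let w , w<16 , p , q , r , p<q , q<r , r<ℓ , Ep , Eq , Er = crowdedWindow 16 ℓ (suc k) E m≤16ℓ many
    in split w w<16 λ s Es high low → windowClique (suc k) J ℓ (w * ℓ) s p q r p<q q<r r<ℓ Ep Eq Er Es high low few
    where
    open ≤-Reasoning
    ℓ = 2 * h + 2

    left : 9 * ℓ + 2 + 2 * J ≤ suc k
    left = +-cancelʳ-≤ 20 _ _ (begin
      9 * (2 * h + 2) + 2 + 2 * J + 20     ≡⟨ e₁ h J ⟩
      18 * h + 20 + 2 * (J + 10)           ≡⟨ cong (λ z → 18 * h + 20 + 2 * z) J+10≡7h ⟩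
      18 * h + 20 + 2 * (7 * h)            ≡⟨ e₂ h ⟩
      32 * h + 20                          ≤⟨ +-monoˡ-≤ 20 32h≤m ⟩
      suc k + 20                           ∎)
      where
      e₁ : ∀ h J → 9 * (2 * h + 2) + 2 + 2 * J + 20 ≡ 18 * h + 20 + 2 * (J + 10)
      e₁ = ℕSolver.solve-∀
      e₂ : ∀ h → 18 * h + 20 + 2 * (7 * h) ≡ 32 * h + 20
      e₂ = ℕSolver.solve-∀

    J-small : 2 * J ≤ 7 * ℓ
    J-small = begin
      2 * J                  ≤⟨ *-monoʳ-≤ 2 (m≤m+n J 10) ⟩
      2 * (J + 10)           ≡⟨ cong (2 *_) J+10≡7h ⟩
      2 * (7 * h)            ≤⟨ m≤m+n _ 14 ⟩
      2 * (7 * h) + 14       ≡⟨ e h ⟩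
      7 * (2 * h + 2)        ∎
      where
      e : ∀ h → 2 * (7 * h) + 14 ≡ 7 * (2 * h + 2)
      e = ℕSolver.solve-∀

    -- The left side equals `48h + 17`, which is at most `64h` as soon as `h ≥ 2`.
    right : 17 * ℓ + 3 + 2 * J ≤ 2 * suc k
    right = +-cancelʳ-≤ 20 _ _ (begin
      17 * (2 * h + 2) + 3 + 2 * J + 20    ≡⟨ e₁ h J ⟩
      34 * h + 37 + 2 * (J + 10)           ≡⟨ cong (λ z → 34 * h + 37 + 2 * z) J+10≡7h ⟩
      34 * h + 37 + 2 * (7 * h)            ≡⟨ e₂ h ⟩
      48 * h + 20 + 17                     ≤⟨ +-monoʳ-≤ (48 * h + 20) (m≤m+n 17 15) ⟩
      48 * h + 20 + 16 * 2                 ≤⟨ +-monoʳ-≤ (48 * h + 20) (*-monoʳ-≤ 16 2≤h) ⟩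
      48 * h + 20 + 16 * h                 ≡⟨ e₃ h ⟩
      2 * (32 * h) + 20                    ≤⟨ +-monoˡ-≤ 20 (*-monoʳ-≤ 2 32h≤m) ⟩
      2 * suc k + 20                       ∎)
      where
      e₁ : ∀ h J → 17 * (2 * h + 2) + 3 + 2 * J + 20 ≡ 34 * h + 37 + 2 * (J + 10)
      e₁ = ℕSolver.solve-∀
      e₂ : ∀ h → 34 * h + 37 + 2 * (7 * h) ≡ 48 * h + 20 + 17
      e₂ = ℕSolver.solve-∀
      e₃ : ∀ h → 48 * h + 20 + 16 * h ≡ 2 * (32 * h) + 20
      e₃ = ℕSolver.solve-∀

    -- s is taken at the end opposite to p, q, r: then there is room for t up to about 7ℓ.
    split : ∀ {X : Set} w → w < 16 →
      (∀ s → E (+ s) ≡ true → w * ℓ + 2 * ℓ + s + 3 + 2 * J ≤ 2 * suc k → ℓ + 2 * J ≤ w * ℓ + s + 1 → X) → X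
    split w w<16 cont with w ≤? 7
    ... | yes w≤7 = cont k E-last
      (begin
        w * ℓ + 2 * ℓ + k + 3 + 2 * J        ≡⟨ e₁ (w * ℓ) ℓ k J ⟩
        suc k + (w * ℓ + 2 * ℓ + 2 + 2 * J)  ≤⟨ +-monoʳ-≤ (suc k) (+-monoˡ-≤ (2 * J) (+-monoˡ-≤ 2 (+-monoˡ-≤ (2 * ℓ) (*-monoˡ-≤ ℓ w≤7)))) ⟩
        suc k + (7 * ℓ + 2 * ℓ + 2 + 2 * J)  ≡⟨ cong (λ z → suc k + (z + 2 + 2 * J)) (sym (*-distribʳ-+ ℓ 7 2)) ⟩
        suc k + (9 * ℓ + 2 + 2 * J)          ≤⟨ +-monoʳ-≤ (suc k) left ⟩
        suc k + suc k                        ≡⟨ cong (λ z → suc k + z) (sym (+-identityʳ (suc k))) ⟩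
        2 * suc k                            ∎)
      (begin
        ℓ + 2 * J                            ≤⟨ +-monoˡ-≤ (2 * J) (≤-trans (m≤m+n ℓ (8 * ℓ)) (m≤m+n (9 * ℓ) 2)) ⟩
        9 * ℓ + 2 + 2 * J                    ≤⟨ left ⟩
        suc k                                ≤⟨ m≤n+m (suc k) (w * ℓ) ⟩
        w * ℓ + suc k                        ≡⟨ e₂ (w * ℓ) k ⟩
        w * ℓ + k + 1                        ∎)
      where
      e₁ : ∀ c ℓ k J → c + 2 * ℓ + k + 3 + 2 * J ≡ suc k + (c + 2 * ℓ + 2 + 2 * J)
      e₁ = ℕSolver.solve-∀
      e₂ : ∀ c k → c + suc k ≡ c + k + 1
      e₂ = ℕSolver.solve-∀
    ... | no w≰7 = cont 0 E-first
      (begin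
        w * ℓ + 2 * ℓ + 0 + 3 + 2 * J        ≡⟨ cong (λ z → z + 3 + 2 * J) (+-identityʳ (w * ℓ + 2 * ℓ)) ⟩
        w * ℓ + 2 * ℓ + 3 + 2 * J            ≤⟨ +-monoˡ-≤ (2 * J) (+-monoˡ-≤ 3 (+-monoˡ-≤ (2 * ℓ) (*-monoˡ-≤ ℓ (s≤s⁻¹ w<16)))) ⟩
        15 * ℓ + 2 * ℓ + 3 + 2 * J           ≡⟨ cong (λ z → z + 3 + 2 * J) (sym (*-distribʳ-+ ℓ 15 2)) ⟩
        17 * ℓ + 3 + 2 * J                   ≤⟨ right ⟩
        2 * suc k                            ∎)
      (begin
        ℓ + 2 * J                            ≤⟨ +-monoʳ-≤ ℓ J-small ⟩
        8 * ℓ                                ≤⟨ *-monoˡ-≤ ℓ (≰⇒> w≰7) ⟩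
        w * ℓ                                ≤⟨ ≤-trans (m≤m+n (w * ℓ) 0) (m≤m+n (w * ℓ + 0) 1) ⟩
        w * ℓ + 0 + 1                        ∎)

  -- The three cases by the density of the even elements.

  module Surplus (C : ℕ) (large₀ : 100 ≤ C) (large₁ : 40 * (41 * 2) ≤ C)
                 (large₂ : next 40 * (suc (next 40) * 3) ≤ C) (large₃ : next (next 40) * 5 ≤ C)
                 (k : ℕ) (E-first : E (+ 0) ≡ true) (E-last : E (+ k) ≡ true)
                 (surplus : ♯ (complement D) (suc k) + C ≤ ♯ E (suc k)) where
    open ≤-Reasoning

    m = suc k
    N = ♯ E m
    O = ♯ (complement D) m

    C≤N : C ≤ N
    C≤N = ≤-trans (m≤n+m C O) surplus

    C≤m : C ≤ m
    C≤m = ≤-trans C≤N (♯≤m E m)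

    0<m : 0 < m
    0<m = z<s

    -- Pairing `E` at density 1/4 with `E` less one element, at density 1/5, leaves density 1/40,
    -- since `40 = 2 * (4 * 5)`.
    half : m ≤ 4 * N → HasSumClique 5 A
    half m≤4N = denseClique A B (+ 0) E E evens evens′ distinct m 40 0<m
      (≤-trans large₁ C≤m) (≤-trans large₂ C≤m) (≤-trans large₃ C≤m)
      (*-positive (*-positiveʳ 4 {N} 0<m m≤4N) (*-positiveʳ 5 {N ∸ 1} 0<m m≤5N-1))
      (λ n → density-pairs 4 5 {N} {N ∸ 1} {n} 0<m m≤4N m≤5N-1)
      where
      evens′ : ∀ z → E z ≡ true → (+ 2 ℤ.* (B ℤ.+ z) ℤ.- + 0) ∈ℤ A
      evens′ z Ez = subst (_∈ℤ A) (sym (ℤ.+-identityʳ _)) (evens z Ez)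
      distinct : ∀ {δ d} → δ ≢ d → + 2 ℤ.* d ≢ + 2 ℤ.* δ ℤ.- + 0
      distinct δ≢d eq = δ≢d (sym (ℤ.*-cancelˡ-≡ (+ 2) _ _ (trans eq (ℤ.+-identityʳ _))))
      m≤5N-1 : m ≤ 5 * (N ∸ 1)
      m≤5N-1 = density-∸ 4 1 {N} 0<m (≤-trans (≤ᵇ⇒≤ 20 100 _) (≤-trans large₀ C≤m)) m≤4N

    middle : m ≤ 14 * N → 4 * N < m → HasSumClique 5 A
    middle m≤14N 4N<m = denseClique A B (+ 1) E D evens odds (λ {δ} {d} _ → double≢double-1 d δ) m 40 0<m
      (≤-trans large₁ C≤m) (≤-trans large₂ C≤m) (≤-trans large₃ C≤m)
      (*-positive (*-positiveʳ 14 {N} 0<m m≤14N) (*-positiveʳ 4 {M} (≤-trans 0<m (m≤m+n m (2 * m))) 3m≤4M))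
      bound
      where
      M = ♯ D m ∸ 1
      e₁ : ∀ m → 4 * m ≡ 3 * m + m
      e₁ = ℕSolver.solve-∀
      -- `O + 1 ≤ O + C ≤ N < m/4`, so `D` keeps three quarters of the window even after losing one
      -- member.
      3m≤4M : 3 * m ≤ 4 * M
      3m≤4M = begin
        3 * m                      ≡⟨ m+n∸n≡m (3 * m) 4 ⟨
        3 * m + 4 ∸ 4              ≤⟨ ∸-monoˡ-≤ {3 * m + 4} {4 * ♯ D m} 4 (+-cancelʳ-≤ (4 * O) (3 * m + 4) (4 * ♯ D m) (begin
          3 * m + 4 + 4 * O              ≡⟨ +-assoc (3 * m) 4 (4 * O) ⟩
          3 * m + (4 + 4 * O)            ≡⟨ cong (λ z → 3 * m + z) (sym (*-distribˡ-+ 4 1 O)) ⟩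
          3 * m + 4 * (1 + O)            ≤⟨ +-monoʳ-≤ (3 * m) (*-monoʳ-≤ 4 (≤-trans (≤-trans (≤-reflexive (+-comm 1 O)) (+-monoʳ-≤ O (≤-trans (≤ᵇ⇒≤ 1 100 _) large₀))) surplus)) ⟩
          3 * m + 4 * N                  ≤⟨ +-monoʳ-≤ (3 * m) (<⇒≤ 4N<m) ⟩
          3 * m + m                      ≡⟨ e₁ m ⟨
          4 * m                          ≡⟨ cong (4 *_) (♯-complement D m) ⟨
          4 * (♯ D m + O)                ≡⟨ *-distribˡ-+ 4 (♯ D m) O ⟩
          4 * ♯ D m + 4 * O              ∎)) ⟩
        4 * ♯ D m ∸ 4              ≡⟨ *-distribˡ-∸ 4 (♯ D m) 1 ⟨
        4 * (♯ D m ∸ 1)            ∎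
      -- `3m² ≤ 56NM ≤ 112mn` gives density at least 3/112; rounding 56 up to 60 brings it to the
      -- 1/40 of the other dense case.
      bound : ∀ n → N * M ≤ (m + m) * n → m ≤ 40 * n
      bound n NM≤ = *-cancelˡ-≤ {m} {40 * n} 3 (*-cancelˡ-≤ {3 * m} {3 * (40 * n)} m (begin
        m * (3 * m)                ≤⟨ *-mono-≤ m≤14N 3m≤4M ⟩
        14 * N * (4 * M)           ≡⟨ e₂ N M ⟩
        56 * (N * M)               ≤⟨ *-monoʳ-≤ 56 NM≤ ⟩
        56 * ((m + m) * n)         ≤⟨ *-monoˡ-≤ ((m + m) * n) (≤ᵇ⇒≤ 56 60 _) ⟩
        60 * ((m + m) * n)         ≡⟨ e₃ m n ⟩
        m * (3 * (40 * n))         ∎))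
        where
        e₂ : ∀ N M → 14 * N * (4 * M) ≡ 56 * (N * M)
        e₂ = ℕSolver.solve-∀
        e₃ : ∀ m n → 60 * ((m + m) * n) ≡ m * (3 * (40 * n))
        e₃ = ℕSolver.solve-∀

    sparse : 14 * N < m → HasSumClique 5 A
    sparse 14N<m = sparseClique k h J 2≤h 32h≤m m≤16ℓ (m∸n+n≡m 10≤7h)
      E-first E-last (≤-trans (≤ᵇ⇒≤ 33 100 _) (≤-trans large₀ C≤N)) 3O<J
      where
      h = m / 32
      J = 7 * h ∸ 10
      ρ = m % 32
      m≡ : m ≡ ρ + h * 32
      m≡ = m≡m%n+[m/n]*n m 32
      32h≤m : 32 * h ≤ m
      32h≤m = ≤-trans (≤-reflexive (*-comm 32 h)) (≤-trans (m≤n+m (h * 32) ρ) (≤-reflexive (sym m≡)))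
      m≤32h+31 : m ≤ 32 * h + 31
      m≤32h+31 = begin
        m               ≡⟨ m≡ ⟩
        ρ + h * 32      ≤⟨ +-monoˡ-≤ (h * 32) (s≤s⁻¹ (m%n<n m 32)) ⟩
        31 + h * 32     ≡⟨ +-comm 31 (h * 32) ⟩
        h * 32 + 31     ≡⟨ cong (_+ 31) (*-comm h 32) ⟩
        32 * h + 31     ∎
      m≤16ℓ : m ≤ 16 * (2 * h + 2)
      m≤16ℓ = begin
        m                      ≤⟨ m≤32h+31 ⟩
        32 * h + 31            ≤⟨ +-monoʳ-≤ (32 * h) (n≤1+n 31) ⟩
        32 * h + 32            ≡⟨ e h ⟩
        16 * (2 * h + 2)       ∎
        where
        e : ∀ h → 32 * h + 32 ≡ 16 * (2 * h + 2)
        e = ℕSolver.solve-∀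
      2≤h : 2 ≤ h
      2≤h = s≤s⁻¹ (*-cancelˡ-< 32 2 (suc h) (begin-strict
        64                     <⟨ ≤ᵇ⇒≤ 65 100 _ ⟩
        100                    ≤⟨ ≤-trans large₀ C≤m ⟩
        m                      ≤⟨ m≤32h+31 ⟩
        32 * h + 31            ≤⟨ +-monoʳ-≤ (32 * h) (n≤1+n 31) ⟩
        32 * h + 32            ≡⟨ +-comm (32 * h) 32 ⟩
        32 + 32 * h            ≡⟨ *-suc 32 h ⟨
        32 * suc h             ∎))
      10≤7h : 10 ≤ 7 * h
      10≤7h = ≤-trans (≤ᵇ⇒≤ 10 14 _) (*-monoʳ-≤ 7 2≤h)
      -- `14 * 3O` lies below `3m`, about `96h`, while `14J = 98h - 140`: this is where the
      -- threshold 14 comes from. The gap of at least 100 between `O` and `N` contributes 4200,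
      -- which covers the 140 and the remainder of `m` modulo 32.
      3O<J : 3 * O < J
      3O<J = *-cancelˡ-< 14 (3 * O) J (+-cancelʳ-< 4200 _ _ (begin-strict
        14 * (3 * O) + 4200          ≡⟨ e₁ O ⟩
        3 * (14 * (O + 100))         ≤⟨ *-monoʳ-≤ 3 (*-monoʳ-≤ 14 (≤-trans (+-monoʳ-≤ O large₀) surplus)) ⟩
        3 * (14 * N)                 <⟨ *-monoʳ-< 3 14N<m ⟩
        3 * m                        ≤⟨ *-monoʳ-≤ 3 m≤32h+31 ⟩
        3 * (32 * h + 31)            ≡⟨ e₂ h ⟩
        96 * h + 93                  ≤⟨ +-mono-≤ (*-monoˡ-≤ h (≤ᵇ⇒≤ 96 98 _)) (≤ᵇ⇒≤ 93 4060 _) ⟩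
        98 * h + 4060                ≡⟨ cong (_+ 4060) (*-assoc 14 7 h) ⟩
        14 * (7 * h) + 4060          ≡⟨ cong (λ z → 14 * z + 4060) (m∸n+n≡m 10≤7h) ⟨
        14 * (J + 10) + 4060         ≡⟨ e₃ J ⟩
        14 * J + 4200                ∎))
        where
        e₁ : ∀ O → 14 * (3 * O) + 4200 ≡ 3 * (14 * (O + 100))
        e₁ = ℕSolver.solve-∀
        e₂ : ∀ h → 3 * (32 * h + 31) ≡ 96 * h + 93
        e₂ = ℕSolver.solve-∀
        e₃ : ∀ J → 14 * (J + 10) + 4060 ≡ 14 * J + 4200
        e₃ = ℕSolver.solve-∀

    hasSumClique : HasSumClique 5 A
    hasSumClique with m ≤? 4 * N
    ... | yes m≤4N = half m≤4N
    ... | no  m≰4N with m ≤? 14 * N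
    ...   | yes m≤14N = middle m≤14N (≰⇒> m≰4N)
    ...   | no  m≰14N = sparse (≰⇒> m≰14N)

-- From the list `A` to index sets.

evenOrOdd : ∀ n a → 1 ≤ a → a ≤ n + n →
  ∃[ i ] i < n × (+ a ≡ + 2 ℤ.* + suc i ⊎ + a ≡ + 2 ℤ.* + suc i ℤ.- + 1)
evenOrOdd n (suc b) _ 1+b≤2n with halve b
... | i , inj₁ refl = i , ≰⇒> (λ n≤i → <⇒≱ 1+b≤2n (+-mono-≤ n≤i n≤i)) , inj₂ (odd (+ i))
  where
  odd : ∀ i → + 1 ℤ.+ (i ℤ.+ i) ≡ + 2 ℤ.* (+ 1 ℤ.+ i) ℤ.- + 1
  odd = ℤSolver.solve-∀
... | i , inj₂ refl = i , ≰⇒> (λ n≤i → <⇒≱ 1+b≤2n (≤-trans (+-mono-≤ n≤i n≤i) (n≤1+n (i + i)))) , inj₁ (even (+ i))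
  where
  even : ∀ i → + 2 ℤ.+ (i ℤ.+ i) ≡ + 2 ℤ.* (+ 1 ℤ.+ i)
  even = ℤSolver.solve-∀

-- The base point `B` records the position of the window. The full range has `B = 1`, index 0
-- standing for the numbers 2 and 1; trimming at `lo` moves it to `lo + 1`.
surplusClique : ∀ C → 100 ≤ C → 40 * (41 * 2) ≤ C → next 40 * (suc (next 40) * 3) ≤ C → next (next 40) * 5 ≤ C →
  ∀ n A → SubsetOf2n n A → n + C ≤ length A → HasSumClique 5 A
surplusClique C large₀ large₁ large₂ large₃ n A (unique , bounded) big =
  let lo , k , first , last , gain = trim n C (λ i → E (+ 1) (+ i)) (λ i → complement (D (+ 1)) (+ i))
                                       (≤-trans (s≤s z≤n) large₀) start
  in Surplus.hasSumClique A (+ suc lo) (E (+ suc lo)) (D (+ suc lo))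
       (λ _ → member) (λ _ → member) C large₀ large₁ large₂ large₃ k
       (subst (λ i → E (+ 1) (+ i) ≡ true) (sym (+-identityʳ lo)) first) last gain
  where
  A′ = List.map +_ A

  E D : ℤ → Pred
  E B z = does ((+ 2 ℤ.* (B ℤ.+ z)) ∈? A′)
  D B z = does ((+ 2 ℤ.* (B ℤ.+ z) ℤ.- + 1) ∈? A′)

  member : ∀ {z} → does (z ∈? A′) ≡ true → z ∈ℤ A
  member {z} z∈ = ∈-map⁻ +_ (does-true (z ∈? A′) z∈)

  -- `length A ≤ |E| + |D|` and `n = |D| + |O|`; cancelling `|D|` turns the size hypothesis into the
  -- surplus.
  start : ♯ (complement (D (+ 1))) n + C ≤ ♯ (E (+ 1)) n
  start = +-cancelʳ-≤ (♯ (D (+ 1)) n) _ _ (begin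
    ♯ (complement (D (+ 1))) n + C + ♯ (D (+ 1)) n       ≡⟨ rearrange _ C (♯ (D (+ 1)) n) ⟩
    ♯ (D (+ 1)) n + ♯ (complement (D (+ 1))) n + C       ≡⟨ cong (_+ C) (♯-complement (D (+ 1)) n) ⟩
    n + C                                                ≤⟨ big ⟩
    length A                                             ≡⟨ length-map +_ A ⟨
    length A′                                            ≤⟨ length≤∑ n (λ i → + 2 ℤ.* + suc i) (λ i → + 2 ℤ.* + suc i ℤ.- + 1) A′
                                                              (Unique.map⁺ ℤ.+-injective unique)
                                                              (All.map⁺ (All.map (λ {a} (1≤a , a≤2n) → evenOrOdd n a 1≤a a≤2n) bounded)) ⟩
    ♯ (E (+ 1)) n + ♯ (D (+ 1)) n                        ∎)
    where
    open ≤-Reasoning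
    rearrange : ∀ a b c → a + b + c ≡ c + a + b
    rearrange = ℕSolver.solve-∀

theorem9 : (n : ℕ) → 1 ≤ n → (A : List ℕ) → SubsetOf2n n A →
    n + 119999999 ≤ length A → HasSumClique 5 A
-- The constant is `1.2·10⁸ - 1` because the bound on `g_5(n)` is strict. The largest of the four
-- demands on it is `next (next 40) * 5 = 107616800`.
theorem9 n _ A = surplusClique 119999999 (≤ᵇ⇒≤ _ _ _) (≤ᵇ⇒≤ _ _ _) (≤ᵇ⇒≤ _ _ _) (≤ᵇ⇒≤ _ _ _) n A
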